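{- Let $n\ge 1$. Among triangle-free graphs of order $n$, the balanced complete bipartite graph $K_{\lfloor n/2\rfloor,\lceil n/2\rceil}$ uniquely maximizes the number of subpaths. That is, every triangle-free graph $G$ of order $n$ satisfies $$\mathrm{pn}(G)\le \mathrm{pn}\bigl(K_{\lfloor n/2\rfloor,\lceil n/2\rceil}\bigr),$$ with equality if and only if $G\cong K_{\lfloor n/2\rfloor,\lceil n/2\rceil}$.
   Context: Graphs are finite and simple; the order of a graph is its number of vertices. For a graph $G$ of order $n$, the number of subpaths (path number) is $\mathrm{pn}(G)=\sum_{i=0}^{n-1}\mathrm{pn}_i(G)$, where $\mathrm{pn}_i(G)$ is the number of (not necessarily induced) subgraphs of $G$ isomorphic to the path $P_{i+1}$ on $i+1$ vertices (so paths are unoriented and single vertices count as paths of length $0$). -}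

module Defs where

open import Data.Fin using (Fin; toℕ)
open import Data.Fin.Properties using (any?; all?) renaming (_≟_ to _≟ᶠ_)
open import Data.Fin.Subset using (Subset; _∈_; inside; outside)
open import Data.Fin.Subset.Properties using (_∈?_)
open import Data.List using (List; []; _∷_; map; filter; length; upTo; cartesianProductWith)
open import Data.Nat using (ℕ; zero; suc; _+_; _≤_; _<_; _≤?_; _<?_)
open import Data.Nat.ListAction using (sum)
open import Data.Nat.Properties using (_≟_; 1+n≢n; <⇒≱)
open import Data.Product using (Σ; ∃; _×_; _,_; proj₁; proj₂)
open import Data.Sum using (_⊎_; inj₁; inj₂; swap)
open import Data.Vec using (Vec; []; _∷_; lookup; tabulate)
open import Data.Vec.Properties using (lookup∘tabulate)
open import Data.Vec.Properties.WithK using ([]=-irrelevant)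
open import Function using (_∘_)
open import Function.Bundles using (_⇔_; _↔_; mk⇔; mk↔ₛ′; module Equivalence; module Inverse)
open import Relation.Binary.PropositionalEquality using (_≡_; refl; sym; trans; cong; subst; subst₂)
open import Relation.Nullary using (¬_; Dec)
open import Relation.Nullary.Decidable using (map′; _×-dec_; _⊎-dec_; _→-dec_)

record Graph (V : Set) : Set₁ where
  infix 4 _~_ _~?_
  field
    _~_      : V → V → Set
    _~?_     : ∀ u v → Dec (u ~ v)
    ~-sym    : ∀ {u v} → u ~ v → v ~ u
    ~-irrefl : ∀ {v} → ¬ (v ~ v)

infix 4 _≅_

_≅_ : {V W : Set} → Graph V → Graph W → Set
_≅_ {V} {W} G H =
  Σ (V ↔ W) λ f → ∀ u v → (u G.~ v) ⇔ (Inverse.to f u H.~ Inverse.to f v)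
  where
  module G = Graph G
  module H = Graph H

TriangleFree : {V : Set} → Graph V → Set
TriangleFree G = ∀ u v w → ¬ (u ~ v × v ~ w × w ~ u)
  where open Graph G

pathGraph : (m : ℕ) → Graph (Fin m)
pathGraph m = record
  { _~_      = λ u v → (suc (toℕ u) ≡ toℕ v) ⊎ (suc (toℕ v) ≡ toℕ u)
  ; _~?_     = λ u v → (suc (toℕ u) ≟ toℕ v) ⊎-dec (suc (toℕ v) ≟ toℕ u)
  ; ~-sym    = swap
  ; ~-irrefl = λ { (inj₁ e) → 1+n≢n e ; (inj₂ e) → 1+n≢n e }
  }

-- The parts are the first a and the last b elements of Fin (a + b).
completeBipartite : (a b : ℕ) → Graph (Fin (a + b))
completeBipartite a b = record
  { _~_      = λ u v → (toℕ u < a × a ≤ toℕ v) ⊎ (toℕ v < a × a ≤ toℕ u)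
  ; _~?_     = λ u v → ((toℕ u <? a) ×-dec (a ≤? toℕ v))
                         ⊎-dec ((toℕ v <? a) ×-dec (a ≤? toℕ u))
  ; ~-sym    = swap
  ; ~-irrefl = λ { (inj₁ (p , q)) → <⇒≱ p q ; (inj₂ (p , q)) → <⇒≱ p q }
  }

-- Raw data of a graph whose vertices lie in Fin n: a vertex set, and the
-- neighbourhood of each element of Fin n.  When IsSubgraph holds the
-- neighbourhood of a non-vertex is empty, so that distinct codes are
-- distinct subgraphs and every subgraph has exactly one code.
record Code (n : ℕ) : Set where
  constructor code
  field
    vertices   : Subset n
    neighbours : Vec (Subset n) n

  infix 4 _~ᶜ_ _~ᶜ?_

  _~ᶜ_ : Fin n → Fin n → Set
  u ~ᶜ v = v ∈ lookup neighbours u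

  _~ᶜ?_ : ∀ u v → Dec (u ~ᶜ v)
  u ~ᶜ? v = v ∈? lookup neighbours u

record IsSubgraph {n : ℕ} (G : Graph (Fin n)) (H : Code n) : Set where
  open Graph G
  open Code H
  field
    symmetric : ∀ u v → u ~ᶜ v → v ~ᶜ u
    endpoints : ∀ u v → u ~ᶜ v → u ∈ vertices × v ∈ vertices
    edges     : ∀ u v → u ~ᶜ v → u ~ v

subgraph : {n : ℕ} {G : Graph (Fin n)} {H : Code n} →
           IsSubgraph G H → Graph (∃ λ v → v ∈ Code.vertices H)
subgraph {G = G} {H = H} s = record
  { _~_      = λ u v → proj₁ u ~ᶜ proj₁ v
  ; _~?_     = λ u v → proj₁ u ~ᶜ? proj₁ v
  ; ~-sym    = symmetric _ _
  ; ~-irrefl = Graph.~-irrefl G ∘ edges _ _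
  }
  where
  open Code H
  open IsSubgraph s

IsSubgraphIsoTo : {n m : ℕ} → Graph (Fin n) → Graph (Fin m) → Code n → Set
IsSubgraphIsoTo G P H = Σ (IsSubgraph G H) λ s → subgraph s ≅ P

isSubgraph? : {n : ℕ} (G : Graph (Fin n)) (H : Code n) → Dec (IsSubgraph G H)
isSubgraph? G H =
  map′ (λ (a , b , c) → record { symmetric = a ; endpoints = b ; edges = c })
       (λ s → let open IsSubgraph s in symmetric , endpoints , edges)
       (all? (λ u → all? λ v → (u ~ᶜ? v) →-dec (v ~ᶜ? u))
        ×-dec all? (λ u → all? λ v →
                (u ~ᶜ? v) →-dec ((u ∈? vertices) ×-dec (v ∈? vertices)))
        ×-dec all? (λ u → all? λ v → (u ~ᶜ? v) →-dec (u ~? v)))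
  where
  open Graph G
  open Code H

anyVec? : {n : ℕ} (m : ℕ) {Q : Vec (Fin n) m → Set} →
          (∀ φ → Dec (Q φ)) → Dec (∃ Q)
anyVec? zero    Q? = map′ ([] ,_) (λ { ([] , q) → q }) (Q? [])
anyVec? (suc m) Q? =
  map′ (λ (x , φ , q) → (x ∷ φ) , q) (λ { ((x ∷ φ) , q) → x , φ , q })
       (any? λ x → anyVec? m λ φ → Q? (x ∷ φ))

-- φ lists the vertices of H in an order that is an isomorphism from P.
Lists : {n m : ℕ} → Graph (Fin m) → Code n → Vec (Fin n) m → Set
Lists P H φ =
    (∀ i → lookup φ i ∈ vertices)
  × (∀ v → v ∈ vertices → ∃ λ i → lookup φ i ≡ v)
  × (∀ i j → lookup φ i ≡ lookup φ j → i ≡ j)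
  × (∀ i j → lookup φ i ~ᶜ lookup φ j → i ~ j)
  × (∀ i j → i ~ j → lookup φ i ~ᶜ lookup φ j)
  where
  open Graph P
  open Code H

lists? : {n m : ℕ} (P : Graph (Fin m)) (H : Code n) (φ : Vec (Fin n) m) →
         Dec (Lists P H φ)
lists? P H φ =
        all? (λ i → lookup φ i ∈? vertices)
  ×-dec all? (λ v → (v ∈? vertices) →-dec any? (λ i → lookup φ i ≟ᶠ v))
  ×-dec all? (λ i → all? λ j → (lookup φ i ≟ᶠ lookup φ j) →-dec (i ≟ᶠ j))
  ×-dec all? (λ i → all? λ j → (lookup φ i ~ᶜ? lookup φ j) →-dec (i ~? j))
  ×-dec all? (λ i → all? λ j → (i ~? j) →-dec (lookup φ i ~ᶜ? lookup φ j))
  where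
  open Graph P
  open Code H

∈-irrelevant : {n : ℕ} {p : Subset n} {x y : ∃ λ v → v ∈ p} →
               proj₁ x ≡ proj₁ y → x ≡ y
∈-irrelevant {x = v , a} {y = .v , b} refl = cong (v ,_) ([]=-irrelevant a b)

lists⇒≅ : {n m : ℕ} {G : Graph (Fin n)} {P : Graph (Fin m)} {H : Code n}
          (s : IsSubgraph G H) → ∃ (Lists P H) → subgraph s ≅ P
lists⇒≅ {P = P} {H = H} s (φ , inV , onto , inj , fwd , bwd) =
  mk↔ₛ′ to from
    (λ i → inj _ _ (proj₂ (onto _ (inV i))))
    (λ (v , v∈) → ∈-irrelevant (proj₂ (onto v v∈)))
  , λ u v → mk⇔
      (λ e → fwd _ _ (subst₂ _~ᶜ_ (sym (at u)) (sym (at v)) e))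
      (λ e → subst₂ _~ᶜ_ (at u) (at v) (bwd _ _ e))
  where
  open Code H
  to : (∃ λ v → v ∈ vertices) → _
  to (v , v∈) = proj₁ (onto v v∈)
  from : _ → ∃ λ v → v ∈ vertices
  from i = lookup φ i , inV i
  at : ∀ u → lookup φ (to u) ≡ proj₁ u
  at (v , v∈) = proj₂ (onto v v∈)

≅⇒lists : {n m : ℕ} {G : Graph (Fin n)} {P : Graph (Fin m)} {H : Code n}
          (s : IsSubgraph G H) → subgraph s ≅ P → ∃ (Lists P H)
≅⇒lists {P = P} {H = H} s (f , adj) =
    φ
  , (λ i → subst (_∈ vertices) (sym (at i)) (proj₂ (from i)))
  , (λ v v∈ → to (v , v∈) , trans (at _) (cong proj₁ (strictlyInverseʳ (v , v∈))))
  , (λ i j e → trans (sym (strictlyInverseˡ i))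
       (trans (cong to (∈-irrelevant (trans (sym (at i)) (trans e (at j)))))
              (strictlyInverseˡ j)))
  , (λ i j e → subst₂ _~_ (strictlyInverseˡ i) (strictlyInverseˡ j)
       (Equivalence.to (adj (from i) (from j)) (subst₂ _~ᶜ_ (at i) (at j) e)))
  , (λ i j e → subst₂ _~ᶜ_ (sym (at i)) (sym (at j))
       (Equivalence.from (adj (from i) (from j))
         (subst₂ _~_ (sym (strictlyInverseˡ i)) (sym (strictlyInverseˡ j)) e)))
  where
  open Code H
  open Graph P
  open Inverse f using (to; from; strictlyInverseˡ; strictlyInverseʳ)
  φ = tabulate (proj₁ ∘ from)
  at : ∀ i → lookup φ i ≡ proj₁ (from i)
  at = lookup∘tabulate (proj₁ ∘ from)

isSubgraphIsoTo? : {n m : ℕ} (G : Graph (Fin n)) (P : Graph (Fin m)) →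
                   (H : Code n) → Dec (IsSubgraphIsoTo G P H)
isSubgraphIsoTo? {m = m} G P H =
  map′ (λ (s , l) → s , lists⇒≅ {P = P} {H = H} s l) (λ (s , i) → s , ≅⇒lists {P = P} {H = H} s i)
       (isSubgraph? G H ×-dec anyVec? m (lists? P H))

allVecs : {A : Set} → List A → (n : ℕ) → List (Vec A n)
allVecs xs zero    = [] ∷ []
allVecs xs (suc n) = cartesianProductWith _∷_ xs (allVecs xs n)

allSubsets : (n : ℕ) → List (Subset n)
allSubsets = allVecs (inside ∷ outside ∷ [])

allCodes : (n : ℕ) → List (Code n)
allCodes n = cartesianProductWith code (allSubsets n) (allVecs (allSubsets n) n)

pnᵢ : {n : ℕ} → Graph (Fin n) → ℕ → ℕ
pnᵢ {n} G i = length (filter (isSubgraphIsoTo? G (pathGraph (suc i))) (allCodes n))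

pn : {n : ℕ} → Graph (Fin n) → ℕ
pn {n} G = sum (map (pnᵢ G) (upTo n))

{-# OPTIONS --safe #-}
module Submission where

-- Let x₀ x₁ … x₂ₘ be an oriented path and e₁ = x₁x₂, …, eₘ = x₂ₘ₋₁x₂ₘ.  In a triangle-free graph a
-- vertex is adjacent to at most one end of an edge, so the path is recovered from x₀ and the
-- sequence of unoriented edges e₁, …, eₘ; a path with 2m + 2 vertices is likewise recovered from its
-- first edge, oriented, and the following edges.  By Mantel's theorem, applied each time to the
-- vertices not yet used, there are at most ∏ ⌊(n − 2i)² / 4⌋ sequences of m disjoint edges.  All
-- these bounds are attained by the balanced complete bipartite graph.  Equality for paths with two
-- vertices is equality in Mantel's theorem, which characterises that graph.

open import Defs
open import Data.Bool using (Bool; true; false; not; _xor_) renaming (_≟_ to _≟ᵇ_)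
open import Data.Empty using (⊥-elim)
open import Data.Fin using (Fin; toℕ; zero; suc; cast)
open import Data.Fin.Properties using (any?; all?; toℕ-cast; cast-involutive)
  renaming (_≟_ to _≟ᶠ_; suc-injective to suc-injectiveᶠ)
open import Data.Fin.Subset using (Subset) renaming (_∈_ to _∈ˢ_)
open import Data.Fin.Subset.Properties using (⊆-antisym)
open import Data.List using (List; []; _∷_; _++_; map; filter; length; cartesianProductWith; allFin; upTo)
import Data.List as List
open import Data.List.Membership.Propositional using (_∈_)
open import Data.List.Membership.Propositional.Properties using
  ( ∈-allFin; ∈-cartesianProductWith⁺; ∈-filter⁺; ∈-filter⁻; ∈-++⁺ˡ; ∈-++⁺ʳ; ∈-lookup; ∈-upTo⁺ )
open import Data.List.Properties using
  (filter-all; filter-accept; filter-reject; length-++; length-tabulate; map-tabulate)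
open import Data.List.Relation.Unary.All using (All; []; _∷_)
import Data.List.Relation.Unary.All as All
import Data.List.Relation.Unary.All.Properties as All
open import Data.List.Relation.Unary.AllPairs using ([]; _∷_)
open import Data.List.Relation.Unary.Any using (here; there; index)
open import Data.List.Relation.Unary.Any.Properties using (lookup-index)
open import Data.List.Relation.Unary.Unique.Propositional using (Unique)
open import Data.List.Relation.Unary.Unique.Propositional.Properties using
  (cartesianProductWith⁺; allFin⁺; filter⁺; ++⁺)
open import Data.Nat using
  (ℕ; zero; suc; pred; _+_; _*_; _^_; _≤_; _<_; _<?_; _<ᵇ_; z≤n; s≤s; NonZero; >-nonZero; ⌊_/2⌋; ⌈_/2⌉)
open import Data.Nat.ListAction using (sum)
open import Data.Nat.Properties hiding (_≟_)
open import Data.Nat.Tactic.RingSolver using (solve-∀)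
open import Data.Product using (∃; ∃₂; _×_; _,_; proj₁; proj₂)
import Data.Product as Product
open import Data.Sum using (_⊎_; inj₁; inj₂)
import Data.Sum as Sum
open import Data.Vec using (Vec; []; _∷_; lookup; tabulate)
import Data.Vec as Vec
open import Data.Vec.Properties using
  ( ∷-injective; lookup∘tabulate; tabulate∘lookup; tabulate-cong; lookup-map
  ; []=⇒lookup; lookup⇒[]=; ≡-dec )
open import Function using (_∘_; const; id)
open import Function.Bundles using (_⇔_; _↔_; mk⇔; mk↔ₛ′; module Equivalence; module Inverse)
open import Relation.Binary.PropositionalEquality
open import Relation.Nullary using (¬_; Dec; yes; no; does)
open import Relation.Nullary.Decidable using (_×-dec_; _→-dec_; ¬?; dec-true)

open import Algebra.Properties.CommutativeSemigroup +-commutativeSemigroup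
  using (interchange; x∙yz≈y∙xz)

-- The order of choices matters. If x₀ were chosen before the edges, Mantel's theorem on the other n
-- - 1 vertices would bound the oriented paths with three vertices by n ⌊(n - 1)² / 4⌋; for n = 3
-- this is 3, although K₁,₂ has only 2 of them. So x₀ is moved behind the edges, where exactly n -
-- 2m choices are left.
--
-- Mantel's theorem is therefore stated for lists of vertices of one fixed graph and applies at
-- every stage without forming induced subgraphs.
--
-- The path number counts subgraphs, the argument counts injective sequences of vertices. The two
-- differ by the number of automorphisms of the path: a positive factor, the same for both graphs,
-- which cancels from each comparison.

private
  variable
    A B C V : Set

-- Indicators and finite sums

∣_∣ : Dec A → ℕ
∣ yes _ ∣ = 1
∣ no _ ∣ = 0

∣∣-cong : (a? : Dec A) (b? : Dec B) → (A → B) → (B → A) → ∣ a? ∣ ≡ ∣ b? ∣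
∣∣-cong (yes a) (yes b) f g = refl
∣∣-cong (yes a) (no ¬b) f g = ⊥-elim (¬b (f a))
∣∣-cong (no ¬a) (yes b) f g = ⊥-elim (¬a (g b))
∣∣-cong (no ¬a) (no ¬b) f g = refl

∣∣-yes : (a? : Dec A) → A → ∣ a? ∣ ≡ 1
∣∣-yes (yes _) _ = refl
∣∣-yes (no ¬a) a = ⊥-elim (¬a a)

∣∣-no : (a? : Dec A) → ¬ A → ∣ a? ∣ ≡ 0
∣∣-no (yes a) ¬a = ⊥-elim (¬a a)
∣∣-no (no _) _ = refl

∣∣-× : (a? : Dec A) (b? : Dec B) → ∣ a? ×-dec b? ∣ ≡ ∣ a? ∣ * ∣ b? ∣
∣∣-× (yes _) (yes _) = refl
∣∣-× (yes _) (no _) = refl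
∣∣-× (no _) _ = refl

∑ : List A → (A → ℕ) → ℕ
∑ []       f = 0
∑ (x ∷ xs) f = f x + ∑ xs f

∑-cong : (xs : List A) {f g : A → ℕ} → (∀ x → f x ≡ g x) → ∑ xs f ≡ ∑ xs g
∑-cong []       f≗g = refl
∑-cong (x ∷ xs) f≗g = cong₂ _+_ (f≗g x) (∑-cong xs f≗g)

∑-mono : (xs : List A) {f g : A → ℕ} → (∀ x → f x ≤ g x) → ∑ xs f ≤ ∑ xs g
∑-mono []       f≤g = z≤n
∑-mono (x ∷ xs) f≤g = +-mono-≤ (f≤g x) (∑-mono xs f≤g)

∑-+ : (xs : List A) (f g : A → ℕ) → ∑ xs (λ x → f x + g x) ≡ ∑ xs f + ∑ xs g
∑-+ []       f g = refl
∑-+ (x ∷ xs) f g = trans (cong (f x + g x +_) (∑-+ xs f g)) (interchange (f x) _ _ _)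

∑-*ˡ : (k : ℕ) (xs : List A) (f : A → ℕ) → ∑ xs (λ x → k * f x) ≡ k * ∑ xs f
∑-*ˡ k []       f = sym (*-zeroʳ k)
∑-*ˡ k (x ∷ xs) f = trans (cong (k * f x +_) (∑-*ˡ k xs f)) (sym (*-distribˡ-+ k (f x) _))

∑-*ʳ : (k : ℕ) (xs : List A) (f : A → ℕ) → ∑ xs (λ x → f x * k) ≡ ∑ xs f * k
∑-*ʳ k xs f = trans (∑-cong xs λ x → *-comm (f x) k) (trans (∑-*ˡ k xs f) (*-comm k _))

∑-const : (k : ℕ) (xs : List A) → ∑ xs (λ _ → k) ≡ length xs * k
∑-const k []       = refl
∑-const k (x ∷ xs) = cong (k +_) (∑-const k xs)

∑-0 : (xs : List A) {f : A → ℕ} → (∀ x → f x ≡ 0) → ∑ xs f ≡ 0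
∑-0 []       f≗0 = refl
∑-0 (x ∷ xs) f≗0 = cong₂ _+_ (f≗0 x) (∑-0 xs f≗0)

∑-swap : (xs : List A) (ys : List B) (f : A → B → ℕ) →
         ∑ xs (λ x → ∑ ys (f x)) ≡ ∑ ys (λ y → ∑ xs (λ x → f x y))
∑-swap []       ys f = sym (∑-0 ys λ _ → refl)
∑-swap (x ∷ xs) ys f =
  trans (cong (∑ ys (f x) +_) (∑-swap xs ys f)) (sym (∑-+ ys (f x) _))

∑-++ : (xs ys : List A) (f : A → ℕ) → ∑ (xs ++ ys) f ≡ ∑ xs f + ∑ ys f
∑-++ []       ys f = refl
∑-++ (x ∷ xs) ys f = trans (cong (f x +_) (∑-++ xs ys f)) (sym (+-assoc (f x) _ _))

∑-map : (g : A → B) (xs : List A) (f : B → ℕ) → ∑ (map g xs) f ≡ ∑ xs (f ∘ g)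
∑-map g []       f = refl
∑-map g (x ∷ xs) f = cong (f (g x) +_) (∑-map g xs f)

∑-cartesianProductWith : (h : A → B → C) (xs : List A) (ys : List B) (f : C → ℕ) →
  ∑ (cartesianProductWith h xs ys) f ≡ ∑ xs (λ x → ∑ ys (λ y → f (h x y)))
∑-cartesianProductWith h []       ys f = refl
∑-cartesianProductWith h (x ∷ xs) ys f =
  trans (∑-++ (map (h x) ys) _ f)
        (cong₂ _+_ (∑-map (h x) ys f) (∑-cartesianProductWith h xs ys f))

length-filter : {P : A → Set} (P? : ∀ x → Dec (P x)) (xs : List A) →
                length (filter P? xs) ≡ ∑ xs (λ x → ∣ P? x ∣)
length-filter P? []       = refl
length-filter P? (x ∷ xs) with P? x
... | yes _ = cong suc (length-filter P? xs)
... | no _  = length-filter P? xs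

-- The source of every equality case: it is applied to the vertices around an edge in Mantel's
-- theorem, to the rows of an edge count, and to the lengths of paths in the path number.
∑-≡ : {f g : A → ℕ} (xs : List A) → (∀ x → f x ≤ g x) → ∑ xs g ≤ ∑ xs f →
      All (λ x → f x ≡ g x) xs
∑-≡ []       f≤g ge = []
∑-≡ {f = f} {g} (x ∷ xs) f≤g ge =
    ≤-antisym (f≤g x) (+-cancelʳ-≤ (∑ xs g) _ _
      (≤-trans ge (+-monoʳ-≤ (f x) (∑-mono xs f≤g))))
  ∷ ∑-≡ xs f≤g (+-cancelˡ-≤ (g x) _ _ (≤-trans ge (+-monoˡ-≤ _ (f≤g x))))

Enumerates : List A → Set
Enumerates xs = Unique xs × (∀ x → x ∈ xs)

∑-δ : {xs : List A} {a : A} → Unique xs → a ∈ xs → (a? : ∀ x → Dec (x ≡ a)) (f : A → ℕ) →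
      ∑ xs (λ x → ∣ a? x ∣ * f x) ≡ f a
∑-δ {xs = x ∷ xs} (x∉ ∷ u) (here refl) a? f =
  trans (cong₂ _+_ (cong (_* f x) (∣∣-yes (a? x) refl)) (rest xs x∉))
        (trans (+-identityʳ _) (+-identityʳ _))
  where
  rest : ∀ zs → All (x ≢_) zs → ∑ zs (λ z → ∣ a? z ∣ * f z) ≡ 0
  rest []       []         = refl
  rest (z ∷ zs) (x≢z ∷ ps) =
    cong₂ _+_ (cong (_* f z) (∣∣-no (a? z) (x≢z ∘ sym))) (rest zs ps)
∑-δ {xs = x ∷ xs} (x∉ ∷ u) (there a∈) a? f =
  trans (cong (λ k → k * f x + _) (∣∣-no (a? x) (All.lookup x∉ a∈))) (∑-δ u a∈ a? f)

∑-one : {xs : List A} {a : A} {P : A → Set} → Enumerates xs → (P? : ∀ x → Dec (P x)) →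
        P a → (∀ x → P x → x ≡ a) → ∑ xs (λ x → ∣ P? x ∣) ≡ 1
∑-one {xs = xs} {a} {P} (u , all) P? pa only =
  trans (∑-cong xs (λ x → trans (∣∣-cong (P? x) (a? x) (only x) λ { refl → pa })
                                (sym (*-identityʳ _))))
        (∑-δ u (all a) a? (λ _ → 1))
  where
  -- Equality with `a` is decided through `P?`, so the lemma applies directly to types such as
  -- `Code n`.
  a? : ∀ x → Dec (x ≡ a)
  a? x with P? x
  ... | yes p = yes (only x p)
  ... | no ¬p = no λ { refl → ¬p pa }

allVecs-enumerates : {xs : List A} → Enumerates xs → ∀ n → Enumerates (allVecs xs n)
allVecs-enumerates e zero = ([] ∷ []) , λ { [] → here refl }
allVecs-enumerates e@(u , all) (suc n) =
    cartesianProductWith⁺ _∷_ ∷-injective u (proj₁ (allVecs-enumerates e n))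
  , λ { (x ∷ φ) → ∈-cartesianProductWith⁺ _∷_ (all x) (proj₂ (allVecs-enumerates e n) φ) }

-- Copies and embeddings

allFin-enumerates : ∀ n → Enumerates (allFin n)
allFin-enumerates n = allFin⁺ n , ∈-allFin

allSubsets-enumerates : ∀ n → Enumerates (allSubsets n)
allSubsets-enumerates = allVecs-enumerates
  ( ((λ ()) ∷ []) ∷ [] ∷ []
  , λ { true → here refl ; false → there (here refl) })

allCodes-enumerates : ∀ n → Enumerates (allCodes n)
allCodes-enumerates n =
    cartesianProductWith⁺ code (λ { refl → refl , refl })
      (proj₁ (allSubsets-enumerates n)) (proj₁ nbrs)
  , λ { (code s t) → ∈-cartesianProductWith⁺ code (proj₂ (allSubsets-enumerates n) s) (proj₂ nbrs t) }
  where
  nbrs = allVecs-enumerates (allSubsets-enumerates n) n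

lookup-ext : {A : Set} {m : ℕ} {φ ψ : Vec A m} → (∀ i → lookup φ i ≡ lookup ψ i) → φ ≡ ψ
lookup-ext {φ = φ} {ψ} e =
  trans (sym (tabulate∘lookup φ)) (trans (tabulate-cong e) (tabulate∘lookup ψ))

subset : {n : ℕ} {P : Fin n → Set} → (∀ v → Dec (P v)) → Subset n
subset P? = tabulate (does ∘ P?)

∈-subset⁺ : {n : ℕ} {P : Fin n → Set} (P? : ∀ v → Dec (P v)) {v : Fin n} → P v → v ∈ˢ subset P?
∈-subset⁺ P? {v} p =
  lookup⇒[]= v _ (trans (lookup∘tabulate (does ∘ P?) v) (dec-true (P? v) p))

∈-subset⁻ : {n : ℕ} {P : Fin n → Set} (P? : ∀ v → Dec (P v)) {v : Fin n} → v ∈ˢ subset P? → P v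
∈-subset⁻ P? {v} v∈ with P? v | trans (sym (lookup∘tabulate (does ∘ P?) v)) ([]=⇒lookup v∈)
... | yes p | _ = p

infixr 9 _⊙_

_⊙_ : {A : Set} {m k : ℕ} → Vec A m → Vec (Fin m) k → Vec A k
φ ⊙ σ = Vec.map (lookup φ) σ

module Copies {m : ℕ} (P : Graph (Fin m)) where
  open Graph P

  IsAut : Vec (Fin m) m → Set
  IsAut σ = (∀ k → ∃ λ i → lookup σ i ≡ k)
          × (∀ i j → lookup σ i ≡ lookup σ j → i ≡ j)
          × (∀ i j → lookup σ i ~ lookup σ j → i ~ j)
          × (∀ i j → i ~ j → lookup σ i ~ lookup σ j)

  isAut? : ∀ σ → Dec (IsAut σ)
  isAut? σ = all? (λ k → any? λ i → lookup σ i ≟ᶠ k)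
       ×-dec all? (λ i → all? λ j → (lookup σ i ≟ᶠ lookup σ j) →-dec (i ≟ᶠ j))
       ×-dec all? (λ i → all? λ j → (lookup σ i ~? lookup σ j) →-dec (i ~? j))
       ×-dec all? (λ i → all? λ j → (i ~? j) →-dec (lookup σ i ~? lookup σ j))

  #aut : ℕ
  #aut = ∑ (allVecs (allFin m) m) (λ σ → ∣ isAut? σ ∣)

  module _ {n : ℕ} where

    vecs : List (Vec (Fin n) m)
    vecs = allVecs (allFin n) m

    vecs-enumerates : Enumerates vecs
    vecs-enumerates = allVecs-enumerates (allFin-enumerates n) m

    -- Relative to one listing φ₀ of H, the listings of H are the φ₀ ∘ σ for σ an automorphism.
    listings : (H : Code n) → ∃ (Lists P H) → ∑ vecs (λ φ → ∣ lists? P H φ ∣) ≡ #aut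
    listings H (φ₀ , inV , onto , inj , fwd , bwd) =
      trans (∑-cong vecs by-aut)
        (trans (∑-swap vecs auts _) (∑-cong auts by-vec))
      where
      open Code H
      auts = allVecs (allFin m) m
      _≟ⱽ_ : (φ ψ : Vec (Fin n) m) → Dec (φ ≡ ψ)
      _≟ⱽ_ = ≡-dec _≟ᶠ_
      at : ∀ σ i → lookup (φ₀ ⊙ σ) i ≡ lookup φ₀ (lookup σ i)
      at σ i = lookup-map i (lookup φ₀) σ

      aut⇒lists : ∀ σ → IsAut σ → Lists P H (φ₀ ⊙ σ)
      aut⇒lists σ (sur , inj′ , fwd′ , bwd′) =
          (λ i → subst (_∈ˢ vertices) (sym (at σ i)) (inV _))
        , (λ v v∈ → let i , e = onto v v∈ ; j , e′ = sur i in
             j , trans (at σ j) (trans (cong (lookup φ₀) e′) e))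
        , (λ i j e → inj′ i j (inj _ _ (trans (sym (at σ i)) (trans e (at σ j)))))
        , (λ i j e → fwd′ i j (fwd _ _ (subst₂ _~ᶜ_ (at σ i) (at σ j) e)))
        , (λ i j e → subst₂ _~ᶜ_ (sym (at σ i)) (sym (at σ j)) (bwd _ _ (bwd′ i j e)))

      module _ (φ : Vec (Fin n) m) (l : Lists P H φ) where
        inV′ = proj₁ l
        onto′ = proj₁ (proj₂ l)
        inj″ = proj₁ (proj₂ (proj₂ l))
        fwd″ = proj₁ (proj₂ (proj₂ (proj₂ l)))
        bwd″ = proj₂ (proj₂ (proj₂ (proj₂ l)))

        quotient : Vec (Fin m) m
        quotient = tabulate λ i → proj₁ (onto _ (inV′ i))

        at′ : ∀ i → lookup φ₀ (lookup quotient i) ≡ lookup φ i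
        at′ i = trans (cong (lookup φ₀) (lookup∘tabulate _ i)) (proj₂ (onto _ (inV′ i)))

        quotient-factors : φ ≡ φ₀ ⊙ quotient
        quotient-factors = lookup-ext λ i → sym (trans (at quotient i) (at′ i))

        quotient-aut : IsAut quotient
        quotient-aut =
            (λ k → let i , e = onto′ _ (inV k) in
               i , inj _ _ (trans (at′ i) e))
          , (λ i j e → inj″ i j (trans (sym (at′ i)) (trans (cong (lookup φ₀) e) (at′ j))))
          , (λ i j e → fwd″ i j (subst₂ _~ᶜ_ (at′ i) (at′ j) (bwd _ _ e)))
          , (λ i j e → fwd _ _ (subst₂ _~ᶜ_ (sym (at′ i)) (sym (at′ j)) (bwd″ i j e)))

      by-aut : ∀ φ → ∣ lists? P H φ ∣ ≡ ∑ auts (λ σ → ∣ isAut? σ ×-dec (φ ≟ⱽ (φ₀ ⊙ σ)) ∣)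
      by-aut φ with lists? P H φ
      ... | yes l = sym (∑-one (allVecs-enumerates (allFin-enumerates m) m) _
              (quotient-aut φ l , quotient-factors φ l)
              λ σ (_ , e) → lookup-ext λ i → inj _ _
                (trans (sym (at σ i)) (trans (cong (λ ψ → lookup ψ i) (sym e)) (sym (at′ φ l i)))))
      ... | no ¬l = sym (∑-0 auts λ σ → ∣∣-no (isAut? σ ×-dec (φ ≟ⱽ (φ₀ ⊙ σ)))
              λ (a , e) → ¬l (subst (Lists P H) (sym e) (aut⇒lists σ a)))

      by-vec : ∀ σ → ∑ vecs (λ φ → ∣ isAut? σ ×-dec (φ ≟ⱽ (φ₀ ⊙ σ)) ∣) ≡ ∣ isAut? σ ∣
      by-vec σ =
        trans (∑-cong vecs λ φ → ∣∣-× (isAut? σ) (φ ≟ⱽ (φ₀ ⊙ σ)))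
          (trans (∑-*ˡ ∣ isAut? σ ∣ vecs _)
            (trans (cong (∣ isAut? σ ∣ *_) (∑-one vecs-enumerates (_≟ⱽ (φ₀ ⊙ σ)) refl λ _ e → e))
                   (*-identityʳ _)))

    module _ (G : Graph (Fin n)) where
      private module G = Graph G

      IsEmbedding : Vec (Fin n) m → Set
      IsEmbedding φ = (∀ i j → lookup φ i ≡ lookup φ j → i ≡ j)
                    × (∀ i j → i ~ j → lookup φ i G.~ lookup φ j)

      isEmbedding? : ∀ φ → Dec (IsEmbedding φ)
      isEmbedding? φ =
              all? (λ i → all? λ j → (lookup φ i ≟ᶠ lookup φ j) →-dec (i ≟ᶠ j))
        ×-dec all? (λ i → all? λ j → (i ~? j) →-dec (lookup φ i G.~? lookup φ j))

      #emb : ℕ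
      #emb = ∑ vecs (λ φ → ∣ isEmbedding? φ ∣)

      private
        Listed : Code n → Vec (Fin n) m → Set
        Listed H φ = IsSubgraph G H × Lists P H φ

        listed? : ∀ H φ → Dec (Listed H φ)
        listed? H φ = isSubgraph? G H ×-dec lists? P H φ

      by-code : ∀ H → ∣ isSubgraphIsoTo? G P H ∣ * #aut ≡ ∑ vecs (λ φ → ∣ listed? H φ ∣)
      by-code H with isSubgraphIsoTo? G P H
      ... | yes (s , iso) = trans (+-identityʳ _)
              (trans (sym (listings H (≅⇒lists {P = P} {H = H} s iso)))
                (∑-cong vecs λ φ → ∣∣-cong (lists? P H φ) (listed? H φ) (s ,_) proj₂))
      ... | no ¬iso = sym (∑-0 vecs λ φ → ∣∣-no (listed? H φ)
              λ (s , l) → ¬iso (s , lists⇒≅ {P = P} {H = H} s (φ , l)))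

      module _ (φ : Vec (Fin n) m) where
        imageVertex? : ∀ v → Dec (∃ λ i → lookup φ i ≡ v)
        imageVertex? v = any? λ i → lookup φ i ≟ᶠ v

        imageEdge? : ∀ u v → Dec (∃₂ λ i j → lookup φ i ≡ u × lookup φ j ≡ v × i ~ j)
        imageEdge? u v = any? λ i → any? λ j →
          (lookup φ i ≟ᶠ u) ×-dec (lookup φ j ≟ᶠ v) ×-dec (i ~? j)

        -- Only edges of `P` are carried over, so this subgraph need not be induced.
        image : Code n
        image = code (subset imageVertex?) (tabulate λ u → subset (imageEdge? u))

        open Code image

        edge⁺ : ∀ {u v} → (∃₂ λ i j → lookup φ i ≡ u × lookup φ j ≡ v × i ~ j) → u ~ᶜ v
        edge⁺ {u} {v} e =
          subst (v ∈ˢ_) (sym (lookup∘tabulate (λ u → subset (imageEdge? u)) u)) (∈-subset⁺ (imageEdge? u) e)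

        edge⁻ : ∀ {u v} → u ~ᶜ v → ∃₂ λ i j → lookup φ i ≡ u × lookup φ j ≡ v × i ~ j
        edge⁻ {u} {v} e =
          ∈-subset⁻ (imageEdge? u) (subst (v ∈ˢ_) (lookup∘tabulate (λ u → subset (imageEdge? u)) u) e)

        image-listed : IsEmbedding φ → Listed image φ
        image-listed (inj , pres) =
            record
              { symmetric = λ u v e → let i , j , a , b , r = edge⁻ e in edge⁺ (j , i , b , a , ~-sym r)
              ; endpoints = λ u v e → let i , j , a , b , r = edge⁻ e in
                  ∈-subset⁺ imageVertex? (i , a) , ∈-subset⁺ imageVertex? (j , b)
              ; edges = λ u v e → let i , j , a , b , r = edge⁻ e in subst₂ G._~_ a b (pres i j r)
              }
          , (λ i → ∈-subset⁺ imageVertex? (i , refl))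
          , (λ v → ∈-subset⁻ imageVertex?)
          , inj
          , (λ i j e → let i′ , j′ , a , b , r = edge⁻ e in subst₂ _~_ (inj _ _ a) (inj _ _ b) r)
          , (λ i j r → edge⁺ (i , j , refl , refl , r))

        listed⇒embedding : ∀ H → Listed H φ → IsEmbedding φ
        listed⇒embedding H (s , _ , _ , inj , _ , bwd) =
          inj , λ i j r → IsSubgraph.edges s _ _ (bwd i j r)

        -- `onto` and `fwd` put `H` inside the image, `inV` and `bwd` give the converse. The
        -- `endpoints` condition is what lets an edge of `H` be pulled back along `φ`: both of its
        -- ends are listed vertices.
        listed-unique : ∀ H → Listed H φ → H ≡ image
        listed-unique H (s , inV , onto , inj , fwd , bwd) = cong₂ code
          (⊆-antisym (λ v∈ → ∈-subset⁺ imageVertex? (onto _ v∈))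
                     (λ v∈ → let i , e = ∈-subset⁻ imageVertex? v∈ in
                        subst (_∈ˢ Code.vertices H) e (inV i)))
          (lookup-ext λ u → ⊆-antisym
            (λ {v} e → let u∈ , v∈ = IsSubgraph.endpoints s u v e
                           i , a = onto _ u∈
                           j , b = onto _ v∈ in
               edge⁺ (i , j , a , b , fwd i j (subst₂ (Code._~ᶜ_ H) (sym a) (sym b) e)))
            (λ e → let i , j , a , b , r = edge⁻ e in subst₂ (Code._~ᶜ_ H) a b (bwd i j r)))

        by-listing : ∑ (allCodes n) (λ H → ∣ listed? H φ ∣) ≡ ∣ isEmbedding? φ ∣
        by-listing with isEmbedding? φ
        ... | yes e = ∑-one (allCodes-enumerates n) (λ H → listed? H φ) (image-listed e) listed-unique
        ... | no ¬e = ∑-0 (allCodes n) λ H → ∣∣-no (listed? H φ) (¬e ∘ listed⇒embedding H)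

      -- Double counting of the pairs of a subgraph `H` and a listing `φ` of it. A copy of `P` has
      -- `#aut` listings, and an embedding lists exactly one subgraph, its image.
      copies*aut≡emb : length (filter (isSubgraphIsoTo? G P) (allCodes n)) * #aut ≡ #emb
      copies*aut≡emb =
        trans (cong (_* #aut) (length-filter (isSubgraphIsoTo? G P) (allCodes n)))
          (trans (sym (∑-*ʳ #aut (allCodes n) _))
            (trans (∑-cong (allCodes n) by-code)
              (trans (∑-swap (allCodes n) vecs _) (∑-cong vecs by-listing))))

  #aut-pos : 1 ≤ #aut
  #aut-pos = pos _ (proj₂ (allVecs-enumerates (allFin-enumerates m) m) idᵛ)
    where
    idᵛ = tabulate λ i → i
    at : ∀ i → lookup idᵛ i ≡ i
    at = lookup∘tabulate λ i → i
    isAut-id : IsAut idᵛ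
    isAut-id = (λ k → k , at k)
             , (λ i j e → trans (sym (at i)) (trans e (at j)))
             , (λ i j → subst₂ _~_ (at i) (at j))
             , (λ i j → subst₂ _~_ (sym (at i)) (sym (at j)))
    pos : ∀ xs → idᵛ ∈ xs → 1 ≤ ∑ xs (λ σ → ∣ isAut? σ ∣)
    pos (x ∷ xs) (here refl) = ≤-trans (≤-reflexive (sym (∣∣-yes (isAut? x) isAut-id))) (m≤m+n _ _)
    pos (x ∷ xs) (there i)   = ≤-trans (pos xs i) (m≤n+m _ _)

-- Mantel's theorem

-- The sum of f x ys over all ways to remove one entry x from a list, leaving ys.
∑ᵖ : List V → (V → List V → ℕ) → ℕ
∑ᵖ []       f = 0
∑ᵖ (x ∷ xs) f = f x xs + ∑ᵖ xs (λ y ys → f y (x ∷ ys))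

-- The length hypothesis is for bounds that depend on how many vertices are left.
∑ᵖ-mono-length : (xs : List V) {f g : V → List V → ℕ} →
  (∀ x ys → suc (length ys) ≡ length xs → f x ys ≤ g x ys) → ∑ᵖ xs f ≤ ∑ᵖ xs g
∑ᵖ-mono-length []       f≤g = z≤n
∑ᵖ-mono-length (x ∷ xs) f≤g =
  +-mono-≤ (f≤g x xs refl) (∑ᵖ-mono-length xs λ y ys e → f≤g y (x ∷ ys) (cong suc e))

∑ᵖ-mono : (xs : List V) {f g : V → List V → ℕ} → (∀ x ys → f x ys ≤ g x ys) → ∑ᵖ xs f ≤ ∑ᵖ xs g
∑ᵖ-mono xs f≤g = ∑ᵖ-mono-length xs λ x ys _ → f≤g x ys

∑ᵖ-cong : (xs : List V) {f g : V → List V → ℕ} → (∀ x ys → f x ys ≡ g x ys) → ∑ᵖ xs f ≡ ∑ᵖ xs g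
∑ᵖ-cong []       f≗g = refl
∑ᵖ-cong (x ∷ xs) f≗g = cong₂ _+_ (f≗g x xs) (∑ᵖ-cong xs λ y ys → f≗g y (x ∷ ys))

∑ᵖ-+ : (xs : List V) (f g : V → List V → ℕ) →
       ∑ᵖ xs (λ x ys → f x ys + g x ys) ≡ ∑ᵖ xs f + ∑ᵖ xs g
∑ᵖ-+ []       f g = refl
∑ᵖ-+ (x ∷ xs) f g =
  trans (cong (f x xs + g x xs +_) (∑ᵖ-+ xs _ _)) (interchange (f x xs) _ _ _)

∑ᵖ-*ˡ : (k : ℕ) (xs : List V) (f : V → List V → ℕ) →
        ∑ᵖ xs (λ x ys → k * f x ys) ≡ k * ∑ᵖ xs f
∑ᵖ-*ˡ k []       f = sym (*-zeroʳ k)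
∑ᵖ-*ˡ k (x ∷ xs) f =
  trans (cong (k * f x xs +_) (∑ᵖ-*ˡ k xs _)) (sym (*-distribˡ-+ k (f x xs) _))

∑ᵖ-const : (xs : List V) (h : V → ℕ) → ∑ᵖ xs (λ x _ → h x) ≡ ∑ xs h
∑ᵖ-const []       h = refl
∑ᵖ-const (x ∷ xs) h = cong (h x +_) (∑ᵖ-const xs h)

∑ᵖ² : List V → (V → V → List V → ℕ) → ℕ
∑ᵖ² xs f = ∑ᵖ xs λ x ys → ∑ᵖ ys (f x)

-- Taking out an entry keeps the order of the others, so removing two entries in either order leaves
-- literally the same list as third argument.
∑ᵖ²-swap : (xs : List V) (f : V → V → List V → ℕ) →
           ∑ᵖ² xs f ≡ ∑ᵖ² xs (λ x y → f y x)
∑ᵖ²-swap []       f = refl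
∑ᵖ²-swap (x ∷ xs) f = begin
  ∑ᵖ xs (f x) + ∑ᵖ xs (λ y ys → f y x ys + ∑ᵖ ys (λ z zs → f y z (x ∷ zs)))
    ≡⟨ cong (∑ᵖ xs (f x) +_) (∑ᵖ-+ xs _ _) ⟩
  ∑ᵖ xs (f x) + (∑ᵖ xs (λ y → f y x) + ∑ᵖ² xs (λ y z zs → f y z (x ∷ zs)))
    ≡⟨ cong (λ k → ∑ᵖ xs (f x) + (∑ᵖ xs (λ y → f y x) + k)) (∑ᵖ²-swap xs _) ⟩
  ∑ᵖ xs (f x) + (∑ᵖ xs (λ y → f y x) + ∑ᵖ² xs (λ y z zs → f z y (x ∷ zs)))
    ≡⟨ x∙yz≈y∙xz (∑ᵖ xs (f x)) (∑ᵖ xs (λ y → f y x)) (∑ᵖ² xs (λ y z zs → f z y (x ∷ zs))) ⟩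
  ∑ᵖ xs (λ y → f y x) + (∑ᵖ xs (f x) + ∑ᵖ² xs (λ y z zs → f z y (x ∷ zs)))
    ≡⟨ cong (∑ᵖ xs (λ y → f y x) +_) (∑ᵖ-+ xs _ _) ⟨
  ∑ᵖ xs (λ y → f y x) + ∑ᵖ xs (λ y ys → f x y ys + ∑ᵖ ys (λ z zs → f z y (x ∷ zs))) ∎
  where
  open ≡-Reasoning

∑ᵖ²-+ : (xs : List V) (f g : V → V → List V → ℕ) →
        ∑ᵖ² xs (λ x y ys → f x y ys + g x y ys) ≡ ∑ᵖ² xs f + ∑ᵖ² xs g
∑ᵖ²-+ xs f g = trans (∑ᵖ-cong xs λ x ys → ∑ᵖ-+ ys (f x) (g x)) (∑ᵖ-+ xs _ _)

∑ᵖ²-*ˡ : (k : ℕ) (xs : List V) (f : V → V → List V → ℕ) →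
         ∑ᵖ² xs (λ x y ys → k * f x y ys) ≡ k * ∑ᵖ² xs f
∑ᵖ²-*ˡ k xs f = trans (∑ᵖ-cong xs λ x ys → ∑ᵖ-*ˡ k ys (f x)) (∑ᵖ-*ˡ k xs _)

-- Weights instead of a graph, because the equality case compares the adjacency of `G` with the
-- weight given by a two-colouring.
module Weights (w : V → V → ℕ) (w-sym : ∀ x y → w x y ≡ w y x) where

  #edges : List V → ℕ
  #edges []       = 0
  #edges (x ∷ xs) = ∑ xs (w x) + #edges xs

  ∑ᵖ²-edges : (xs : List V) → ∑ᵖ² xs (λ x y _ → w x y) ≡ 2 * #edges xs
  ∑ᵖ²-edges []       = refl
  ∑ᵖ²-edges (x ∷ xs) = begin
    ∑ᵖ xs (λ y _ → w x y) + ∑ᵖ xs (λ y ys → w y x + ∑ᵖ ys (λ z _ → w y z))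
      ≡⟨ cong₂ _+_ (∑ᵖ-const xs (w x)) (∑ᵖ-+ xs _ _) ⟩
    ∑ xs (w x) + (∑ᵖ xs (λ y _ → w y x) + ∑ᵖ² xs (λ y z _ → w y z))
      ≡⟨ cong₂ (λ a b → ∑ xs (w x) + (a + b))
           (trans (∑ᵖ-const xs _) (∑-cong xs λ y → w-sym y x)) (∑ᵖ²-edges xs) ⟩
    ∑ xs (w x) + (∑ xs (w x) + 2 * #edges xs)
      ≡⟨ double (∑ xs (w x)) _ ⟩
    2 * (∑ xs (w x) + #edges xs) ∎
    where
    open ≡-Reasoning
    double : ∀ a b → a + (a + 2 * b) ≡ 2 * (a + b)
    double = solve-∀

data Pick {V : Set} (x : V) : List V → List V → Set where
  here  : ∀ {xs} → Pick x (x ∷ xs) xs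
  there : ∀ {y xs ys} → Pick x xs ys → Pick x (y ∷ xs) (y ∷ ys)

pick-length : ∀ {x : V} {xs ys} → Pick x xs ys → length xs ≡ suc (length ys)
pick-length here      = refl
pick-length (there p) = cong suc (pick-length p)

∑-pick : ∀ {x : V} {xs ys} → Pick x xs ys → (f : V → ℕ) → ∑ xs f ≡ f x + ∑ ys f
∑-pick here f = refl
∑-pick {x = x} (there {y} {ys = ys} p) f =
  trans (cong (f y +_) (∑-pick p f)) (x∙yz≈y∙xz (f y) (f x) (∑ ys f))

suc*suc : ∀ x y → suc x * suc y ≡ suc (x + y) + x * y
suc*suc = solve-∀

turán : ℕ → ℕ
turán n = ⌊ n /2⌋ * ⌈ n /2⌉

-- The step of Mantel's induction: deleting both ends of an edge loses that edge and at most one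
-- edge for each of the `n` remaining vertices.
turán-2+ : ∀ n → turán (suc (suc n)) ≡ suc n + turán n
turán-2+ n = trans (suc*suc ⌊ n /2⌋ ⌈ n /2⌉) (cong (λ k → suc k + turán n) (⌊n/2⌋+⌈n/2⌉≡n n))

module InGraph (G : Graph V) where
  open Graph G

  e : V → V → ℕ
  e x y = ∣ x ~? y ∣

  e-sym : ∀ x y → e x y ≡ e y x
  e-sym x y = ∣∣-cong (x ~? y) (y ~? x) ~-sym ~-sym

  open Weights e e-sym public

  #edges-pick : ∀ {x : V} {xs ys} → Pick x xs ys → #edges xs ≡ ∑ ys (e x) + #edges ys
  #edges-pick here = refl
  #edges-pick {x} (there {y} {xs} {ys} p) = begin
    ∑ xs (e y) + #edges xs
      ≡⟨ cong₂ _+_ (∑-pick p (e y)) (#edges-pick p) ⟩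
    (e y x + ∑ ys (e y)) + (∑ ys (e x) + #edges ys)
      ≡⟨ interchange (e y x) (∑ ys (e y)) (∑ ys (e x)) (#edges ys) ⟩
    (e y x + ∑ ys (e x)) + (∑ ys (e y) + #edges ys)
      ≡⟨ cong (λ k → (k + ∑ ys (e x)) + (∑ ys (e y) + #edges ys)) (e-sym y x) ⟩
    (e x y + ∑ ys (e x)) + (∑ ys (e y) + #edges ys) ∎
    where
    open ≡-Reasoning

  record PickedEdge (xs : List V) : Set where
    constructor pickedEdge
    field
      {a b}   : V
      {ys zs} : List V
      pick-a  : Pick a xs ys
      pick-b  : Pick b ys zs
      edge    : a ~ b

    length-xs : length xs ≡ suc (suc (length zs))
    length-xs = trans (pick-length pick-a) (cong suc (pick-length pick-b))

    #edges-split : #edges xs ≡ suc (∑ zs (λ z → e a z + e b z) + #edges zs)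
    #edges-split = begin
      #edges xs ≡⟨ #edges-pick pick-a ⟩
      ∑ ys (e a) + #edges ys ≡⟨ cong₂ _+_ (∑-pick pick-b (e a)) (#edges-pick pick-b) ⟩
      (e a b + ∑ zs (e a)) + (∑ zs (e b) + #edges zs)
        ≡⟨ cong (λ k → (k + ∑ zs (e a)) + (∑ zs (e b) + #edges zs)) (∣∣-yes (a ~? b) edge) ⟩
      suc (∑ zs (e a) + (∑ zs (e b) + #edges zs))
        ≡⟨ cong suc (+-assoc (∑ zs (e a)) _ _) ⟨
      suc (∑ zs (e a) + ∑ zs (e b) + #edges zs)
        ≡⟨ cong (λ k → suc (k + #edges zs)) (∑-+ zs (e a) (e b)) ⟨
      suc (∑ zs (λ z → e a z + e b z) + #edges zs) ∎
      where open ≡-Reasoning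

  find-neighbour : ∀ x xs → ∑ xs (e x) ≡ 0 ⊎ ∃₂ λ y ys → Pick y xs ys × x ~ y
  find-neighbour x []       = inj₁ refl
  find-neighbour x (y ∷ xs) with x ~? y | find-neighbour x xs
  ... | yes r | _                      = inj₂ (y , xs , here , r)
  ... | no _  | inj₁ none              = inj₁ none
  ... | no _  | inj₂ (z , ys , p , r) = inj₂ (z , y ∷ ys , there p , r)

  find-edge : ∀ xs → #edges xs ≡ 0 ⊎ PickedEdge xs
  find-edge []       = inj₁ refl
  find-edge (x ∷ xs) with find-neighbour x xs | find-edge xs
  ... | inj₂ (_ , _ , p , r) | _                        = inj₂ (pickedEdge here p r)
  ... | inj₁ _    | inj₂ (pickedEdge p q r) = inj₂ (pickedEdge (there p) (there q) r)
  ... | inj₁ none | inj₁ none′                          = inj₁ (cong₂ _+_ none none′)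

  module _ (tf : TriangleFree G) where

    edge-dominates : ∀ {a b} → a ~ b → ∀ z → e a z + e b z ≤ 1
    edge-dominates {a} {b} r z with a ~? z | b ~? z
    ... | yes p | yes q = ⊥-elim (tf a b z (r , q , ~-sym p))
    ... | yes _ | no _  = s≤s z≤n
    ... | no _  | yes _ = s≤s z≤n
    ... | no _  | no _  = z≤n

    -- Induction by deleting both ends of an edge; no other vertex is adjacent to both of them. The
    -- length is a separate argument `k` because the recursion descends on it by two.
    mantel : ∀ k xs → length xs ≡ k → #edges xs ≤ turán k
    mantel k xs len with find-edge xs
    ... | inj₁ none = subst (_≤ turán k) (sym none) z≤n
    mantel zero xs len          | inj₂ p with trans (sym len) (PickedEdge.length-xs p)
    ... | ()
    mantel (suc zero) xs len    | inj₂ p with trans (sym len) (PickedEdge.length-xs p)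
    ... | ()
    mantel (suc (suc k)) xs len | inj₂ p = begin
      #edges xs ≡⟨ #edges-split ⟩
      suc (∑ zs (λ z → e a z + e b z) + #edges zs)
        ≤⟨ s≤s (+-mono-≤ (∑-mono zs (edge-dominates edge)) (mantel k zs len′)) ⟩
      suc (∑ zs (λ _ → 1) + turán k)
        ≡⟨ cong (λ l → suc (l + turán k)) (trans (∑-const 1 zs) (trans (*-identityʳ _) len′)) ⟩
      suc k + turán k ≡⟨ turán-2+ k ⟨
      turán (suc (suc k)) ∎
      where
      open ≤-Reasoning
      open PickedEdge p
      len′ : length zs ≡ k
      len′ = suc-injective (suc-injective (trans (sym length-xs) len))

    -- The first deletion already carries the information: since the rest obeys Mantel's bound,
    -- equality leaves no slack in the edges between the deleted pair and the other vertices.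
    -- Positivity of the bound guarantees an edge to delete.
    mantel-sharp : ∀ xs → 1 ≤ turán (length xs) → turán (length xs) ≤ #edges xs →
                   ∃ λ ((pickedEdge {a} {b} {ys} {zs} _ _ _) : PickedEdge xs) → All (λ z → e a z + e b z ≡ 1) zs
    mantel-sharp xs pos ge with find-edge xs
    ... | inj₁ none = ⊥-elim (1+n≰n (≤-trans pos (≤-trans ge (≤-reflexive none))))
    ... | inj₂ p = p , ∑-≡ zs (edge-dominates edge) (+-cancelʳ-≤ (turán (length zs)) _ _ (≤-pred (begin
      suc (∑ zs (λ _ → 1) + turán (length zs))
        ≡⟨ cong (λ l → suc (l + turán (length zs))) (trans (∑-const 1 zs) (*-identityʳ _)) ⟩
      suc (length zs) + turán (length zs) ≡⟨ turán-2+ (length zs) ⟨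
      turán (suc (suc (length zs))) ≡⟨ cong turán length-xs ⟨
      turán (length xs) ≤⟨ ge ⟩
      #edges xs ≡⟨ #edges-split ⟩
      suc (∑ zs (λ z → e a z + e b z) + #edges zs)
        ≤⟨ s≤s (+-monoʳ-≤ _ (mantel _ zs refl)) ⟩
      suc (∑ zs (λ z → e a z + e b z) + turán (length zs)) ∎)))
      where
      open ≤-Reasoning
      open PickedEdge p

-- Counting oriented paths

-- Extensions by k vertices of a path ending in one part of a complete bipartite graph, when x
-- vertices of the other part and y of the same part are unused.
bipartiteWalks : ℕ → ℕ → ℕ → ℕ
bipartiteWalks zero    x y = 1
bipartiteWalks (suc k) x y = x * bipartiteWalks k y (pred x)

-- The two summands are the two parts in which the path may start. `pred` of zero is harmless, as
-- that summand has the factor zero.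
bipartitePaths : ℕ → ℕ → ℕ → ℕ
bipartitePaths k x y = x * bipartiteWalks k y (pred x) + y * bipartiteWalks k x (pred y)

bipartiteMatchings : ℕ → (ℕ → ℕ) → ℕ → ℕ → ℕ
bipartiteMatchings zero    g x y = g (x + y)
bipartiteMatchings (suc m) g x y = x * (y * bipartiteMatchings m g (pred x) (pred y))

x*[y*z]≡y*[x*z] : ∀ x y z → x * (y * z) ≡ y * (x * z)
x*[y*z]≡y*[x*z] = solve-∀

bipartiteWalks-even : ∀ m x y → bipartiteWalks (m * 2) x y ≡ bipartiteMatchings m (const 1) x y
bipartiteWalks-even zero    x y = refl
bipartiteWalks-even (suc m) x y = cong (λ k → x * (y * k)) (bipartiteWalks-even m (pred x) (pred y))

bipartiteMatchings-comm : ∀ m x y →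
  bipartiteMatchings m (const 1) x y ≡ bipartiteMatchings m (const 1) y x
bipartiteMatchings-comm zero    x y = refl
bipartiteMatchings-comm (suc m) x y =
  trans (cong (λ k → x * (y * k)) (bipartiteMatchings-comm m (pred x) (pred y)))
        (x*[y*z]≡y*[x*z] x y _)

-- The first two vertices lie in different parts and contribute `x * y`; what follows is a path
-- counted from scratch in parts smaller by one each.
bipartitePaths-even : ∀ m x y → bipartitePaths (m * 2) x y ≡ bipartiteMatchings m id x y
bipartitePaths-even zero    x y = cong₂ _+_ (*-identityʳ x) (*-identityʳ y)
bipartitePaths-even (suc m) x y =
  trans (factor x y (pred x * bipartiteWalks (m * 2) (pred y) (pred (pred x)))
                    (pred y * bipartiteWalks (m * 2) (pred x) (pred (pred y))))
        (cong (λ k → x * (y * k)) (bipartitePaths-even m (pred x) (pred y)))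
  where
  factor : ∀ x y a b → x * (y * a) + y * (x * b) ≡ x * (y * (a + b))
  factor = solve-∀

-- The factor 2 is the orientation of the first edge, that is, the part in which the path starts.
bipartitePaths-odd : ∀ m x y →
  bipartitePaths (suc (m * 2)) x y ≡ 2 * bipartiteMatchings (suc m) (const 1) x y
bipartitePaths-odd m x y = begin
  x * (y * bipartiteWalks (m * 2) x′ y′) + y * (x * bipartiteWalks (m * 2) y′ x′)
    ≡⟨ cong₂ (λ a b → x * (y * a) + y * (x * b))
         (bipartiteWalks-even m x′ y′)
         (trans (bipartiteWalks-even m y′ x′) (bipartiteMatchings-comm m y′ x′)) ⟩
  x * (y * bipartiteMatchings m (const 1) x′ y′) + y * (x * bipartiteMatchings m (const 1) x′ y′)
    ≡⟨ double x y _ ⟩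
  2 * (x * (y * bipartiteMatchings m (const 1) x′ y′)) ∎
  where
  open ≡-Reasoning
  x′ = pred x
  y′ = pred y
  double : ∀ x y a → x * (y * a) + y * (x * a) ≡ 2 * (x * (y * a))
  double = solve-∀

parity : ∀ k → ∃ λ m → k ≡ m * 2 ⊎ k ≡ suc (m * 2)
parity zero = 0 , inj₁ refl
parity (suc k) with parity k
... | m , inj₁ e = m , inj₂ (cong suc e)
... | m , inj₂ e = suc m , inj₁ (cong suc e)

module Paths (G : Graph V) where
  open Graph G
  open InGraph G public

  walks : ℕ → V → List V → ℕ
  walks zero    x ys = 1
  walks (suc k) x ys = ∑ᵖ ys λ y zs → e x y * walks k y zs

  paths : ℕ → List V → ℕ
  paths k xs = ∑ᵖ xs (walks k)

  -- Sequences of m disjoint oriented edges, weighted by g of the number of vertices left over.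
  matchings : ℕ → (ℕ → ℕ) → List V → ℕ
  matchings zero    g xs = g (length xs)
  matchings (suc m) g xs = ∑ᵖ² xs λ a b zs → e a b * matchings m g zs

  -- Moves the starting vertex behind the edges: it is swapped past the two ends of each edge in
  -- turn, and at the end it has as many choices as there are vertices left over.
  ∑ᵖ-matchings : ∀ m xs → ∑ᵖ xs (λ _ → matchings m (const 1)) ≡ matchings m id xs
  ∑ᵖ-matchings zero xs =
    trans (∑ᵖ-const xs (const 1)) (trans (∑-const 1 xs) (*-identityʳ _))
  ∑ᵖ-matchings (suc m) xs = begin
    ∑ᵖ² xs (λ w a ys → ∑ᵖ ys λ b zs → e a b * matchings m (const 1) zs)
      ≡⟨ ∑ᵖ²-swap xs (λ w a ys → ∑ᵖ ys λ b zs → e a b * matchings m (const 1) zs) ⟩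
    ∑ᵖ xs (λ a ys → ∑ᵖ² ys λ w b zs → e a b * matchings m (const 1) zs)
      ≡⟨ ∑ᵖ-cong xs (λ a ys → ∑ᵖ²-swap ys λ w b zs → e a b * matchings m (const 1) zs) ⟩
    ∑ᵖ² xs (λ a b ys → ∑ᵖ ys λ w zs → e a b * matchings m (const 1) zs)
      ≡⟨ ∑ᵖ-cong xs (λ a ys → ∑ᵖ-cong ys λ b zs →
           trans (∑ᵖ-*ˡ (e a b) zs _) (cong (e a b *_) (∑ᵖ-matchings m zs))) ⟩
    ∑ᵖ² xs (λ a b zs → e a b * matchings m id zs) ∎
    where open ≡-Reasoning

  module _ (tf : TriangleFree G) where

    -- Whichever edge is taken, the number of remaining vertices is the same, so the bound `K` for
    -- the rest factors out and leaves twice the number of edges, to which Mantel's theorem applies.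
    matchings-max : ∀ m g xs →
      matchings m g xs ≤ 2 ^ m * bipartiteMatchings m g ⌊ length xs /2⌋ ⌈ length xs /2⌉
    matchings-max zero g xs = ≤-reflexive
      (trans (cong g (sym (⌊n/2⌋+⌈n/2⌉≡n (length xs)))) (sym (*-identityˡ _)))
    matchings-max (suc m) g xs = begin
      ∑ᵖ² xs (λ a b zs → e a b * matchings m g zs)
        ≤⟨ ∑ᵖ-mono-length xs (λ a ys p → ∑ᵖ-mono-length ys λ b zs q → step a b zs (trans (cong suc q) p)) ⟩
      ∑ᵖ² xs (λ a b _ → K * e a b)
        ≡⟨ ∑ᵖ²-*ˡ K xs (λ a b _ → e a b) ⟩
      K * ∑ᵖ² xs (λ a b _ → e a b)
        ≡⟨ cong (K *_) (∑ᵖ²-edges xs) ⟩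
      K * (2 * #edges xs)
        ≤⟨ *-monoʳ-≤ K (*-monoʳ-≤ 2 (mantel tf _ xs refl)) ⟩
      K * (2 * (x * y))
        ≡⟨ regroup (2 ^ m) _ x y ⟩
      2 * 2 ^ m * (x * (y * bipartiteMatchings m g (pred x) (pred y))) ∎
      where
      open ≤-Reasoning
      x = ⌊ length xs /2⌋
      y = ⌈ length xs /2⌉
      K = 2 ^ m * bipartiteMatchings m g (pred x) (pred y)
      step : ∀ a b zs → suc (suc (length zs)) ≡ length xs → e a b * matchings m g zs ≤ K * e a b
      step a b zs p = ≤-trans (*-monoʳ-≤ (e a b) (≤-trans (matchings-max m g zs)
        -- At two more than `length zs`, each `pred` of a half computes to the corresponding half of
        -- `length zs`.
        (≤-reflexive (cong (λ l → 2 ^ m * bipartiteMatchings m g (pred ⌊ l /2⌋) (pred ⌈ l /2⌉)) p))))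
        (≤-reflexive (*-comm (e a b) K))
      regroup : ∀ t b x y → t * b * (2 * (x * y)) ≡ 2 * t * (x * (y * b))
      regroup = solve-∀

    -- At most one orientation of the edge ab extends a path ending in w.
    one-orientation : ∀ w a b k → e w a * (e a b * k) + e w b * (e b a * k) ≤ e a b * k
    one-orientation w a b k = begin
      e w a * (e a b * k) + e w b * (e b a * k)
        ≡⟨ cong (λ i → e w a * (e a b * k) + e w b * (i * k)) (e-sym b a) ⟩
      e w a * (e a b * k) + e w b * (e a b * k)
        ≡⟨ collect (e w a) (e w b) (e a b) k ⟩
      e a b * (e w a + e w b) * k
        ≤⟨ *-monoˡ-≤ k bound ⟩
      e a b * k ∎
      where
      open ≤-Reasoning
      collect : ∀ p q r k → p * (r * k) + q * (r * k) ≡ r * (p + q) * k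
      collect = solve-∀
      bound : e a b * (e w a + e w b) ≤ e a b
      bound with a ~? b
      ... | no _  = z≤n
      ... | yes r = ≤-trans (≤-reflexive (trans (+-identityʳ _) (cong₂ _+_ (e-sym w a) (e-sym w b))))
                            (edge-dominates tf r w)

    -- Each further edge gains a factor 2. Twice the sum over ordered pairs (a, b) is the sum of
    -- both orientations, and of these only one can continue a path from `w`.
    walks-max : ∀ m w xs → 2 ^ m * walks (m * 2) w xs ≤ matchings m (const 1) xs
    walks-max zero    w xs = ≤-refl
    walks-max (suc m) w xs = begin
      2 * 2 ^ m * ∑ᵖ xs (λ a ys → e w a * ∑ᵖ ys λ b zs → e a b * walks (m * 2) b zs)
        ≡⟨ cong (2 * 2 ^ m *_) (∑ᵖ-cong xs λ a ys → sym (∑ᵖ-*ˡ (e w a) ys _)) ⟩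
      2 * 2 ^ m * ∑ᵖ² xs (λ a b zs → e w a * (e a b * walks (m * 2) b zs))
        ≡⟨ *-assoc 2 (2 ^ m) _ ⟩
      2 * (2 ^ m * ∑ᵖ² xs (λ a b zs → e w a * (e a b * walks (m * 2) b zs)))
        ≡⟨ cong (2 *_) (∑ᵖ²-*ˡ (2 ^ m) xs _) ⟨
      2 * ∑ᵖ² xs (λ a b zs → 2 ^ m * (e w a * (e a b * walks (m * 2) b zs)))
        -- The induction hypothesis comes before the symmetrisation: it replaces a count that
        -- depends on the end `b` by `M zs`, which is symmetric in `a` and `b`.
        ≤⟨ *-monoʳ-≤ 2 (∑ᵖ-mono xs λ a ys → ∑ᵖ-mono ys λ b zs → step a b zs) ⟩
      2 * ∑ᵖ² xs F
        ≡⟨ cong (∑ᵖ² xs F +_) (+-identityʳ _) ⟩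
      ∑ᵖ² xs F + ∑ᵖ² xs F
        ≡⟨ cong (∑ᵖ² xs F +_) (∑ᵖ²-swap xs F) ⟩
      ∑ᵖ² xs F + ∑ᵖ² xs (λ a b → F b a)
        ≡⟨ ∑ᵖ²-+ xs F (λ a b → F b a) ⟨
      ∑ᵖ² xs (λ a b zs → F a b zs + F b a zs)
        ≤⟨ ∑ᵖ-mono xs (λ a ys → ∑ᵖ-mono ys λ b zs → one-orientation w a b (M zs)) ⟩
      ∑ᵖ² xs (λ a b zs → e a b * M zs) ∎
      where
      open ≤-Reasoning
      M = matchings m (const 1)
      F : V → V → List V → ℕ
      F a b zs = e w a * (e a b * M zs)
      pull : ∀ t p q k → t * (p * (q * k)) ≡ p * (q * (t * k))
      pull = solve-∀
      step : ∀ a b zs → 2 ^ m * (e w a * (e a b * walks (m * 2) b zs)) ≤ F a b zs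
      step a b zs = ≤-trans (≤-reflexive (pull (2 ^ m) (e w a) (e a b) _))
        (*-monoʳ-≤ (e w a) (*-monoʳ-≤ (e a b) (walks-max m b zs)))

    paths-max-even : ∀ m xs → 2 ^ m * paths (m * 2) xs ≤ matchings m id xs
    paths-max-even m xs = begin
      2 ^ m * paths (m * 2) xs                  ≡⟨ ∑ᵖ-*ˡ (2 ^ m) xs _ ⟨
      ∑ᵖ xs (λ w ys → 2 ^ m * walks (m * 2) w ys) ≤⟨ ∑ᵖ-mono xs (walks-max m) ⟩
      ∑ᵖ xs (λ _ → matchings m (const 1))       ≡⟨ ∑ᵖ-matchings m xs ⟩
      matchings m id xs                         ∎
      where open ≤-Reasoning

    -- The first edge keeps its orientation, so only `m` of the `m + 1` edges gain a factor 2.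
    paths-max-odd : ∀ m xs → 2 ^ m * paths (suc (m * 2)) xs ≤ matchings (suc m) (const 1) xs
    paths-max-odd m xs = begin
      2 ^ m * ∑ᵖ² xs (λ a b zs → e a b * walks (m * 2) b zs)
        ≡⟨ ∑ᵖ²-*ˡ (2 ^ m) xs _ ⟨
      ∑ᵖ² xs (λ a b zs → 2 ^ m * (e a b * walks (m * 2) b zs))
        ≤⟨ ∑ᵖ-mono xs (λ a ys → ∑ᵖ-mono ys λ b zs →
             ≤-trans (≤-reflexive (x*[y*z]≡y*[x*z] (2 ^ m) (e a b) _))
                     (*-monoʳ-≤ (e a b) (walks-max m b zs))) ⟩
      matchings (suc m) (const 1) xs ∎
      where open ≤-Reasoning

    -- Both sides are compared after multiplication by `2 ^ m`, the number of orientations of `m`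
    -- edges, which is then cancelled.
    paths-max : ∀ k xs → paths k xs ≤ bipartitePaths k ⌊ length xs /2⌋ ⌈ length xs /2⌉
    paths-max k xs with parity k
    ... | m , inj₁ refl = *-cancelˡ-≤ (2 ^ m) {{m^n≢0 2 m}} (begin
      2 ^ m * paths (m * 2) xs                      ≤⟨ paths-max-even m xs ⟩
      matchings m id xs                             ≤⟨ matchings-max m id xs ⟩
      2 ^ m * bipartiteMatchings m id x y           ≡⟨ cong (2 ^ m *_) (bipartitePaths-even m x y) ⟨
      2 ^ m * bipartitePaths (m * 2) x y            ∎)
      where
      open ≤-Reasoning
      x = ⌊ length xs /2⌋
      y = ⌈ length xs /2⌉
    ... | m , inj₂ refl = *-cancelˡ-≤ (2 ^ m) {{m^n≢0 2 m}} (begin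
      2 ^ m * paths (suc (m * 2)) xs                     ≤⟨ paths-max-odd m xs ⟩
      matchings (suc m) (const 1) xs                     ≤⟨ matchings-max (suc m) (const 1) xs ⟩
      2 * 2 ^ m * bipartiteMatchings (suc m) (const 1) x y ≡⟨ cong (_* bipartiteMatchings (suc m) (const 1) x y) (*-comm 2 (2 ^ m)) ⟩
      2 ^ m * 2 * bipartiteMatchings (suc m) (const 1) x y ≡⟨ *-assoc (2 ^ m) 2 _ ⟩
      2 ^ m * (2 * bipartiteMatchings (suc m) (const 1) x y) ≡⟨ cong (2 ^ m *_) (bipartitePaths-odd m x y) ⟨
      2 ^ m * bipartitePaths (suc (m * 2)) x y           ∎)
      where
      open ≤-Reasoning
      x = ⌊ length xs /2⌋
      y = ⌈ length xs /2⌉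

-- Path counts in two-coloured graphs

bit : Bool → ℕ
bit true  = 1
bit false = 0

module Colouring (c : V → Bool) where

  trues falses : List V → ℕ
  trues  xs = ∑ xs (bit ∘ c)
  falses xs = ∑ xs (bit ∘ not ∘ c)

  trues+falses : ∀ xs → trues xs + falses xs ≡ length xs
  trues+falses []       = refl
  trues+falses (x ∷ xs) with c x
  ... | true  = cong suc (trues+falses xs)
  ... | false = trans (+-suc _ _) (cong suc (trues+falses xs))

  -- The summand sees only the colour of the removed vertex and how many vertices of each colour
  -- remain, so equal terms can be collected.
  ∑ᵖ-colour : ∀ xs (g : Bool → ℕ → ℕ → ℕ) →
    ∑ᵖ xs (λ x ys → g (c x) (trues ys) (falses ys))
      ≡ trues xs * g true (pred (trues xs)) (falses xs)
        + falses xs * g false (trues xs) (pred (falses xs))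
  ∑ᵖ-colour []       g = refl
  ∑ᵖ-colour (x ∷ xs) g with c x
  ... | true  = trans (cong (g true t f +_)
                  (∑ᵖ-colour xs λ b i j → g b (suc i) j))
                (trans (sym (+-assoc (g true t f) _ _))
                  (cong (_+ f * g false (suc t) (pred f)) (absorb t)))
    where
    t = trues xs
    f = falses xs
    -- `suc (pred t)` differs from `t` only at zero, where the term has the factor zero.
    absorb : ∀ t → g true t f + t * g true (suc (pred t)) f ≡ suc t * g true t f
    absorb zero    = refl
    absorb (suc t) = refl
  ... | false = trans (cong (g false t f +_)
                  (∑ᵖ-colour xs λ b i j → g b i (suc j)))
                (trans (x∙yz≈y∙xz (g false t f) (t * g true (pred t) (suc f)) _)
                  (cong (t * g true (pred t) (suc f) +_) (absorb f)))
    where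
    t = trues xs
    f = falses xs
    absorb : ∀ f → g false t f + f * g false t (suc (pred f)) ≡ suc f * g false t f
    absorb zero    = refl
    absorb (suc f) = refl

  module _ (G : Graph V) where
    open Paths G

    module _ (bipartite : ∀ u v → e u v ≡ bit (c u xor c v)) where

      private
        walksFrom : ℕ → Bool → ℕ → ℕ → ℕ
        walksFrom k true  t f = bipartiteWalks k f t
        walksFrom k false t f = bipartiteWalks k t f

      walks-bipartite : ∀ k x ys → walks k x ys ≡ walksFrom k (c x) (trues ys) (falses ys)
      walks-bipartite zero x ys with c x
      ... | true  = refl
      ... | false = refl
      walks-bipartite (suc k) x ys = begin
        ∑ᵖ ys (λ y zs → e x y * walks k y zs)
          ≡⟨ ∑ᵖ-cong ys (λ y zs → cong₂ _*_ (bipartite x y) (walks-bipartite k y zs)) ⟩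
        ∑ᵖ ys (λ y zs → bit (c x xor c y) * walksFrom k (c y) (trues zs) (falses zs))
          ≡⟨ ∑ᵖ-colour ys (λ b t f → bit (c x xor b) * walksFrom k b t f) ⟩
        trues ys * (bit (c x xor true) * bipartiteWalks k (falses ys) (pred (trues ys)))
          + falses ys * (bit (c x xor false) * bipartiteWalks k (trues ys) (pred (falses ys)))
          ≡⟨ other (c x) ⟩
        walksFrom (suc k) (c x) (trues ys) (falses ys) ∎
        where
        open ≡-Reasoning
        t = trues ys
        f = falses ys
        other : ∀ b → t * (bit (b xor true) * bipartiteWalks k f (pred t))
                        + f * (bit (b xor false) * bipartiteWalks k t (pred f))
                      ≡ walksFrom (suc k) b t f
        other true  = cong₂ _+_ (*-zeroʳ t) (cong (f *_) (+-identityʳ _))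
        other false = trans (cong₂ _+_ (cong (t *_) (+-identityʳ _)) (*-zeroʳ f)) (+-identityʳ _)

      paths-bipartite : ∀ k xs → paths k xs ≡ bipartitePaths k (trues xs) (falses xs)
      paths-bipartite k xs =
        trans (∑ᵖ-cong xs (walks-bipartite k)) (∑ᵖ-colour xs (walksFrom k))

-- Embeddings of the path graph as oriented paths

module PathEmbeddings {n : ℕ} (G : Graph (Fin n)) where
  open Graph G
  open Paths G
  open import Data.List.Membership.DecPropositional (_≟ᶠ_ {n}) using (_∈?_)

  remove : Fin n → List (Fin n) → List (Fin n)
  remove x = filter (λ y → ¬? (x ≟ᶠ y))

  -- Links the recursion over positions of a list with sums over all of `Fin n`, as they arise from
  -- enumerating vectors. Uniqueness makes removing a vertex the same as removing its position.
  ∑ᵖ-remove : {xs : List (Fin n)} → Unique xs → (f : Fin n → List (Fin n) → ℕ) →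
              ∑ᵖ xs f ≡ ∑ (allFin n) (λ x → ∣ x ∈? xs ∣ * f x (remove x xs))
  ∑ᵖ-remove []                 f = sym (∑-0 (allFin n) λ x → refl)
  ∑ᵖ-remove {y ∷ xs} (y∉ ∷ u) f = begin
    f y xs + ∑ᵖ xs (λ x ys → f x (y ∷ ys))
      ≡⟨ cong₂ _+_ (sym (∑-δ (allFin⁺ n) (∈-allFin y) (_≟ᶠ y) (λ x → f x xs)))
                   (∑ᵖ-remove u λ x ys → f x (y ∷ ys)) ⟩
    ∑ (allFin n) (λ x → ∣ x ≟ᶠ y ∣ * f x xs)
      + ∑ (allFin n) (λ x → ∣ x ∈? xs ∣ * f x (y ∷ remove x xs))
      ≡⟨ ∑-+ (allFin n) _ _ ⟨
    ∑ (allFin n) (λ x → ∣ x ≟ᶠ y ∣ * f x xs + ∣ x ∈? xs ∣ * f x (y ∷ remove x xs))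
      ≡⟨ ∑-cong (allFin n) split ⟩
    ∑ (allFin n) (λ x → ∣ x ∈? (y ∷ xs) ∣ * f x (remove x (y ∷ xs))) ∎
    where
    open ≡-Reasoning
    split : ∀ x → ∣ x ≟ᶠ y ∣ * f x xs + ∣ x ∈? xs ∣ * f x (y ∷ remove x xs)
                ≡ ∣ x ∈? (y ∷ xs) ∣ * f x (remove x (y ∷ xs))
    split x = by-cases (x ≟ᶠ y)
      where
      P? = λ z → ¬? (x ≟ᶠ z)
      by-cases : (x≟y : Dec (x ≡ y)) →
                 ∣ x≟y ∣ * f x xs + ∣ x ∈? xs ∣ * f x (y ∷ remove x xs)
                 ≡ ∣ x ∈? (y ∷ xs) ∣ * f x (remove x (y ∷ xs))
      by-cases (yes refl) = begin
        f x xs + 0 + ∣ x ∈? xs ∣ * f x (x ∷ remove x xs)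
          ≡⟨ cong (λ k → f x xs + 0 + k * f x (x ∷ remove x xs))
                  (∣∣-no (x ∈? xs) λ x∈ → All.lookup y∉ x∈ refl) ⟩
        f x xs + 0 + 0
          ≡⟨ +-identityʳ _ ⟩
        1 * f x xs
          ≡⟨ cong₂ (λ k zs → k * f x zs) (∣∣-yes (x ∈? (x ∷ xs)) (here refl))
               (trans (filter-reject P? (λ x≢x → x≢x refl)) (filter-all P? y∉)) ⟨
        ∣ x ∈? (x ∷ xs) ∣ * f x (remove x (x ∷ xs)) ∎
      by-cases (no x≢y) = cong₂ (λ k zs → k * f x zs)
        (∣∣-cong (x ∈? xs) (x ∈? (y ∷ xs)) there
          λ { (here e) → ⊥-elim (x≢y e) ; (there i) → i })
        (sym (filter-accept P? x≢y))

  Consecutive : {k : ℕ} → Vec (Fin n) k → Set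
  Consecutive {k} φ = ∀ i j → Graph._~_ (pathGraph k) i j → lookup φ i ~ lookup φ j

  consecutive⁺ : ∀ {k w x} {φ : Vec (Fin n) k} →
                 w ~ x → Consecutive (x ∷ φ) → Consecutive (w ∷ x ∷ φ)
  consecutive⁺ r c zero          zero          (inj₁ ())
  consecutive⁺ r c zero          zero          (inj₂ ())
  consecutive⁺ r c zero          (suc zero)    _ = r
  consecutive⁺ r c zero          (suc (suc j)) (inj₁ ())
  consecutive⁺ r c zero          (suc (suc j)) (inj₂ ())
  consecutive⁺ r c (suc zero)    zero          _ = ~-sym r
  consecutive⁺ r c (suc (suc i)) zero          (inj₁ ())
  consecutive⁺ r c (suc (suc i)) zero          (inj₂ ())
  consecutive⁺ r c (suc i)       (suc j)       a =
    c i j (Sum.map suc-injective suc-injective a)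

  consecutive⁻ : ∀ {k w} {φ : Vec (Fin n) k} → Consecutive (w ∷ φ) → Consecutive φ
  consecutive⁻ c i j a = c (suc i) (suc j) (Sum.map (cong suc) (cong suc) a)

  Injective : {k : ℕ} → Vec (Fin n) k → Set
  Injective φ = ∀ i j → lookup φ i ≡ lookup φ j → i ≡ j

  injective⁺ : ∀ {k x} {φ : Vec (Fin n) k} →
               (∀ i → x ≢ lookup φ i) → Injective φ → Injective (x ∷ φ)
  injective⁺ x∉ inj zero    zero    e = refl
  injective⁺ x∉ inj zero    (suc j) e = ⊥-elim (x∉ j e)
  injective⁺ x∉ inj (suc i) zero    e = ⊥-elim (x∉ i (sym e))
  injective⁺ x∉ inj (suc i) (suc j) e = cong suc (inj i j e)

  injective⁻ : ∀ {k x} {φ : Vec (Fin n) k} → Injective (x ∷ φ) → Injective φ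
  injective⁻ inj i j e = suc-injectiveᶠ (inj (suc i) (suc j) e)

  head-fresh : ∀ {k x} {φ : Vec (Fin n) k} → Injective (x ∷ φ) → ∀ i → x ≢ lookup φ i
  head-fresh inj i e with inj zero (suc i) e
  ... | ()

  -- `w` enters only through its adjacency to the first vertex; that `φ` avoids `w` is left to `xs`,
  -- from which `w` has been removed wherever embeddings are counted.
  Walk : {k : ℕ} → Fin n → List (Fin n) → Vec (Fin n) k → Set
  Walk w xs φ = (∀ i → lookup φ i ∈ xs) × Injective φ × Consecutive (w ∷ φ)

  walk? : ∀ {k} w xs (φ : Vec (Fin n) k) → Dec (Walk w xs φ)
  walk? {k} w xs φ =
          all? (λ i → lookup φ i ∈? xs)
    ×-dec all? (λ i → all? λ j → (lookup φ i ≟ᶠ lookup φ j) →-dec (i ≟ᶠ j))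
    ×-dec all? (λ i → all? λ j → Graph._~?_ (pathGraph (suc k)) i j →-dec (lookup (w ∷ φ) i ~? lookup (w ∷ φ) j))

  walk⁺ : ∀ {k w xs x} {φ : Vec (Fin n) k} →
          x ∈ xs × w ~ x × Walk x (remove x xs) φ → Walk w xs (x ∷ φ)
  walk⁺ {xs = xs} {x} (x∈ , r , φ∈ , inj , c) =
      (λ { zero → x∈ ; (suc i) → proj₁ (∈-filter⁻ (λ y → ¬? (x ≟ᶠ y)) (φ∈ i)) })
    , injective⁺ (λ i → proj₂ (∈-filter⁻ (λ y → ¬? (x ≟ᶠ y)) {xs = xs} (φ∈ i))) inj
    , consecutive⁺ r c

  walk⁻ : ∀ {k w xs x} {φ : Vec (Fin n) k} →
          Walk w xs (x ∷ φ) → x ∈ xs × w ~ x × Walk x (remove x xs) φ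
  walk⁻ {x = x} (φ∈ , inj , c) =
      φ∈ zero
    , c zero (suc zero) (inj₁ refl)
    , (λ i → ∈-filter⁺ (λ y → ¬? (x ≟ᶠ y)) (φ∈ (suc i)) (head-fresh inj i))
    , injective⁻ inj
    , consecutive⁻ c

  ∑-walk : ∀ k w {xs} → Unique xs →
           ∑ (allVecs (allFin n) k) (λ φ → ∣ walk? w xs φ ∣) ≡ walks k w xs
  ∑-walk zero    w {xs} u = trans (+-identityʳ _) (∣∣-yes (walk? w xs []) ((λ ()) , (λ ()) , λ { zero zero (inj₁ ()) ; zero zero (inj₂ ()) }))
  ∑-walk (suc k) w {xs} u = begin
    ∑ (allVecs (allFin n) (suc k)) (λ φ → ∣ walk? w xs φ ∣)
      ≡⟨ ∑-cartesianProductWith _∷_ (allFin n) (allVecs (allFin n) k) (λ φ → ∣ walk? w xs φ ∣) ⟩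
    ∑ (allFin n) (λ x → ∑ (allVecs (allFin n) k) λ φ → ∣ walk? w xs (x ∷ φ) ∣)
      ≡⟨ ∑-cong (allFin n) (λ x → begin
           ∑ (allVecs (allFin n) k) (λ φ → ∣ walk? w xs (x ∷ φ) ∣)
             ≡⟨ ∑-cong (allVecs (allFin n) k) (split x) ⟩
           ∑ (allVecs (allFin n) k) (λ φ → ∣ x ∈? xs ∣ * (e w x * ∣ walk? x (remove x xs) φ ∣))
             ≡⟨ ∑-*ˡ ∣ x ∈? xs ∣ (allVecs (allFin n) k) _ ⟩
           ∣ x ∈? xs ∣ * ∑ (allVecs (allFin n) k) (λ φ → e w x * ∣ walk? x (remove x xs) φ ∣)
             ≡⟨ cong (∣ x ∈? xs ∣ *_) (∑-*ˡ (e w x) (allVecs (allFin n) k) _) ⟩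
           ∣ x ∈? xs ∣ * (e w x * ∑ (allVecs (allFin n) k) (λ φ → ∣ walk? x (remove x xs) φ ∣))
             ≡⟨ cong (λ s → ∣ x ∈? xs ∣ * (e w x * s)) (∑-walk k x (filter⁺ (λ y → ¬? (x ≟ᶠ y)) u)) ⟩
           ∣ x ∈? xs ∣ * (e w x * walks k x (remove x xs)) ∎) ⟩
    ∑ (allFin n) (λ x → ∣ x ∈? xs ∣ * (e w x * walks k x (remove x xs)))
      ≡⟨ ∑ᵖ-remove u (λ x ys → e w x * walks k x ys) ⟨
    walks (suc k) w xs ∎
    where
    open ≡-Reasoning
    split : ∀ x φ → ∣ walk? w xs (x ∷ φ) ∣ ≡ ∣ x ∈? xs ∣ * (e w x * ∣ walk? x (remove x xs) φ ∣)
    split x φ =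
      trans (∣∣-cong (walk? w xs (x ∷ φ)) ((x ∈? xs) ×-dec ((w ~? x) ×-dec walk? x (remove x xs) φ)) walk⁻ walk⁺)
        (trans (∣∣-× (x ∈? xs) ((w ~? x) ×-dec walk? x (remove x xs) φ))
               (cong (∣ x ∈? xs ∣ *_) (∣∣-× (w ~? x) (walk? x (remove x xs) φ))))

  #emb≡paths : ∀ k → Copies.#emb (pathGraph (suc k)) G ≡ paths k (allFin n)
  #emb≡paths k = begin
    ∑ (allVecs (allFin n) (suc k)) (λ φ → ∣ isEmbedding? G φ ∣)
      ≡⟨ ∑-cartesianProductWith _∷_ (allFin n) (allVecs (allFin n) k) (λ φ → ∣ isEmbedding? G φ ∣) ⟩
    ∑ (allFin n) (λ x → ∑ (allVecs (allFin n) k) λ φ → ∣ isEmbedding? G (x ∷ φ) ∣)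
      ≡⟨ ∑-cong (allFin n) (λ x → ∑-cong (allVecs (allFin n) k) λ φ →
           ∣∣-cong (isEmbedding? G (x ∷ φ)) (walk? x (remove x (allFin n)) φ)
             (λ (inj , c) → (λ i → ∈-filter⁺ (λ y → ¬? (x ≟ᶠ y)) (∈-allFin _) (head-fresh inj i))
                            , injective⁻ inj , c)
             (λ (φ∈ , inj , c) →
                injective⁺ (λ i → proj₂ (∈-filter⁻ (λ y → ¬? (x ≟ᶠ y)) {xs = allFin n} (φ∈ i))) inj , c)) ⟩
    ∑ (allFin n) (λ x → ∑ (allVecs (allFin n) k) λ φ → ∣ walk? x (remove x (allFin n)) φ ∣)
      ≡⟨ ∑-cong (allFin n) (λ x → trans (∑-walk k x (filter⁺ (λ y → ¬? (x ≟ᶠ y)) (allFin⁺ n)))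
           (sym (trans (cong (_* walks k x (remove x (allFin n))) (∣∣-yes (x ∈? allFin n) (∈-allFin x)))
                       (+-identityʳ _)))) ⟩
    ∑ (allFin n) (λ x → ∣ x ∈? allFin n ∣ * walks k x (remove x (allFin n)))
      ≡⟨ ∑ᵖ-remove (allFin⁺ n) (walks k) ⟨
    paths k (allFin n) ∎
    where
    open ≡-Reasoning
    open Copies (pathGraph (suc k)) using (isEmbedding?)

  pnᵢ*#aut : ∀ k → pnᵢ G k * Copies.#aut (pathGraph (suc k)) ≡ paths k (allFin n)
  pnᵢ*#aut k = trans (Copies.copies*aut≡emb (pathGraph (suc k)) G) (#emb≡paths k)

-- The complete bipartite graph as a two-coloured graph

bit-xor-comm : ∀ x y → bit (x xor y) ≡ bit (y xor x)
bit-xor-comm true  true  = refl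
bit-xor-comm true  false = refl
bit-xor-comm false true  = refl
bit-xor-comm false false = refl

bit-xor-not : ∀ x y → bit (not x xor not y) ≡ bit (x xor y)
bit-xor-not true  true  = refl
bit-xor-not true  false = refl
bit-xor-not false true  = refl
bit-xor-not false false = refl

∣∣-⇔ : {A B : Set} (a? : Dec A) (b? : Dec B) → ∣ a? ∣ ≡ ∣ b? ∣ → A ⇔ B
∣∣-⇔ (yes a) (yes b) _ = mk⇔ (λ _ → b) (λ _ → a)
∣∣-⇔ (no ¬a) (no ¬b) _ = mk⇔ (⊥-elim ∘ ¬a) (⊥-elim ∘ ¬b)

-- Both sums are the double sum over the graph of the bijection, taken in the two orders.
∑-↔ : ∀ {m n} (f : Fin m ↔ Fin n) (h : Fin n → ℕ) →
      ∑ (allFin m) (h ∘ Inverse.to f) ≡ ∑ (allFin n) h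
∑-↔ {m} {n} f h = begin
  ∑ (allFin m) (h ∘ to)
    ≡⟨ ∑-cong (allFin m) (λ u → ∑-δ (allFin⁺ n) (∈-allFin (to u)) (_≟ᶠ to u) h) ⟨
  ∑ (allFin m) (λ u → ∑ (allFin n) λ v → ∣ v ≟ᶠ to u ∣ * h v)
    ≡⟨ ∑-swap (allFin m) (allFin n) _ ⟩
  ∑ (allFin n) (λ v → ∑ (allFin m) λ u → ∣ v ≟ᶠ to u ∣ * h v)
    ≡⟨ ∑-cong (allFin n) (λ v → trans (∑-*ʳ (h v) (allFin m) (λ u → ∣ v ≟ᶠ to u ∣))
         (trans (cong (_* h v) (∑-one (allFin-enumerates m) (λ u → v ≟ᶠ to u)
                  (sym (strictlyInverseˡ v))
                  (λ u e → trans (sym (strictlyInverseʳ u)) (cong from (sym e)))))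
                (+-identityʳ _))) ⟩
  ∑ (allFin n) h ∎
  where
  open ≡-Reasoning
  open Inverse f using (to; from; strictlyInverseˡ; strictlyInverseʳ)

module CompleteBipartite (a b : ℕ) where
  K = completeBipartite a b
  open Graph K

  left : Fin (a + b) → Bool
  left v = toℕ v <ᵇ a

  bipartite : ∀ u v → ∣ u ~? v ∣ ≡ bit (left u xor left v)
  -- `left u` is by computation the boolean of the decision `toℕ u <? a`.
  bipartite u v = by-sides (toℕ u <? a) (toℕ v <? a)
    where
    by-sides : (p : Dec (toℕ u < a)) (q : Dec (toℕ v < a)) → ∣ u ~? v ∣ ≡ bit (does p xor does q)
    by-sides (yes p) (yes q) = ∣∣-no (u ~? v) λ
      { (inj₁ (_ , r)) → <⇒≱ q r ; (inj₂ (_ , r)) → <⇒≱ p r }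
    by-sides (yes p) (no q)  = ∣∣-yes (u ~? v) (inj₁ (p , ≮⇒≥ q))
    by-sides (no p)  (yes q) = ∣∣-yes (u ~? v) (inj₂ (q , ≮⇒≥ p))
    by-sides (no p)  (no q)  = ∣∣-no (u ~? v) λ
      { (inj₁ (r , _)) → p r ; (inj₂ (r , _)) → q r }

  #left : ∑ (allFin (a + b)) (bit ∘ left) ≡ a
  #left = count a
    where
    count : ∀ a → ∑ (allFin (a + b)) (λ v → bit (toℕ v <ᵇ a)) ≡ a
    count zero    = ∑-0 (allFin b) λ _ → refl
    count (suc a) = cong suc (begin
      ∑ (List.tabulate {n = a + b} suc) (λ v → bit (toℕ v <ᵇ suc a))
        ≡⟨ cong (λ vs → ∑ vs (λ v → bit (toℕ v <ᵇ suc a))) (map-tabulate {n = a + b} (λ v → v) suc) ⟨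
      ∑ (map suc (allFin (a + b))) (λ v → bit (toℕ v <ᵇ suc a))
        ≡⟨ ∑-map suc (allFin (a + b)) (λ v → bit (toℕ v <ᵇ suc a)) ⟩
      ∑ (allFin (a + b)) (λ v → bit (toℕ v <ᵇ a))
        ≡⟨ count a ⟩
      a ∎)
      where
      open ≡-Reasoning

  -- Covers K itself as well as every graph isomorphic to it.
  paths-≅ : ∀ {n} (G : Graph (Fin n)) → G ≅ K → ∀ k → Paths.paths G k (allFin n) ≡ bipartitePaths k a b
  paths-≅ {n} G (f , adj) k = trans (paths-bipartite G edge k (allFin n))
                                    (cong₂ (bipartitePaths k) #trues #falses)
    where
    open Inverse f using (to)
    open Colouring (left ∘ to)
    edge : ∀ u v → ∣ Graph._~?_ G u v ∣ ≡ bit (left (to u) xor left (to v))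
    edge u v = trans (∣∣-cong (Graph._~?_ G u v) (to u ~? to v)
                        (Equivalence.to (adj u v)) (Equivalence.from (adj u v)))
                     (bipartite (to u) (to v))
    #trues : trues (allFin n) ≡ a
    #trues = trans (∑-↔ f (bit ∘ left)) #left
    n≡a+b : n ≡ a + b
    n≡a+b = begin
      n                            ≡⟨ length-tabulate {n = n} (λ v → v) ⟨
      length (allFin n)            ≡⟨ trans (∑-const 1 (allFin n)) (*-identityʳ _) ⟨
      ∑ (allFin n) (λ _ → 1)       ≡⟨ ∑-↔ f (λ _ → 1) ⟩
      ∑ (allFin (a + b)) (λ _ → 1) ≡⟨ trans (∑-const 1 (allFin (a + b))) (*-identityʳ _) ⟩
      length (allFin (a + b))      ≡⟨ length-tabulate {n = a + b} (λ v → v) ⟩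
      a + b                        ∎
      where open ≡-Reasoning
    #falses : falses (allFin n) ≡ b
    #falses = +-cancelˡ-≡ a _ _ (trans (cong (_+ falses (allFin n)) (sym #trues))
      (trans (trues+falses (allFin n)) (trans (length-tabulate {n = n} (λ v → v)) n≡a+b)))

  paths-K : ∀ k → Paths.paths K k (allFin (a + b)) ≡ bipartitePaths k a b
  paths-K = paths-≅ K (mk↔ₛ′ (λ v → v) (λ v → v) (λ _ → refl) (λ _ → refl) , λ _ _ → mk⇔ (λ r → r) (λ r → r))

-- Two-coloured graphs isomorphic to a complete bipartite graph

lookup-injective : {A : Set} {xs : List A} → Unique xs → ∀ i j → List.lookup xs i ≡ List.lookup xs j → i ≡ j
lookup-injective (x∉ ∷ u) zero    zero    e = refl
lookup-injective (x∉ ∷ u) zero    (suc j) e = ⊥-elim (All.lookup x∉ (∈-lookup j) e)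
lookup-injective (x∉ ∷ u) (suc i) zero    e = ⊥-elim (All.lookup x∉ (∈-lookup i) (sym e))
lookup-injective (x∉ ∷ u) (suc i) (suc j) e = cong suc (lookup-injective u i j e)

module BipartiteIso {n : ℕ} (G : Graph (Fin n)) (c : Fin n → Bool) where
  open Graph G
  open Colouring c

  side : Bool → List (Fin n)
  side b = filter (λ v → c v ≟ᵇ b) (allFin n)

  -- The `true` vertices come first, as the first part does in `completeBipartite`; the position in
  -- this list is the isomorphism.
  sides : List (Fin n)
  sides = side true ++ side false

  length-true : length (side true) ≡ trues (allFin n)
  length-true = trans (length-filter (λ v → c v ≟ᵇ true) (allFin n))
                      (∑-cong (allFin n) λ v → is-true (c v))
    where
    is-true : ∀ b → ∣ b ≟ᵇ true ∣ ≡ bit b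
    is-true true  = refl
    is-true false = refl

  length-false : length (side false) ≡ falses (allFin n)
  length-false = trans (length-filter (λ v → c v ≟ᵇ false) (allFin n))
                       (∑-cong (allFin n) λ v → is-false (c v))
    where
    is-false : ∀ b → ∣ b ≟ᵇ false ∣ ≡ bit (not b)
    is-false true  = refl
    is-false false = refl

  sides-unique : Unique sides
  sides-unique = ++⁺ (filter⁺ (λ v → c v ≟ᵇ true) (allFin⁺ n)) (filter⁺ (λ v → c v ≟ᵇ false) (allFin⁺ n))
    λ (v∈ , v∈′) → true≢false (trans (sym (proj₂ (∈-filter⁻ (λ v → c v ≟ᵇ true) {xs = allFin n} v∈)))
                                     (proj₂ (∈-filter⁻ (λ v → c v ≟ᵇ false) {xs = allFin n} v∈′)))
    where
    true≢false : true ≢ false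
    true≢false ()

  sides-complete : ∀ v → v ∈ sides
  sides-complete v with c v in eq
  ... | true  = ∈-++⁺ˡ (∈-filter⁺ (λ v → c v ≟ᵇ true) (∈-allFin v) eq)
  ... | false = ∈-++⁺ʳ (side true) (∈-filter⁺ (λ v → c v ≟ᵇ false) (∈-allFin v) eq)

  colour-lookup : ∀ xs {ys} → All (λ v → c v ≡ true) xs → All (λ v → c v ≡ false) ys →
                  ∀ i → c (List.lookup (xs ++ ys) i) ≡ (toℕ i <ᵇ length xs)
  colour-lookup []       []       fs i = All.lookup fs (∈-lookup i)
  colour-lookup (x ∷ xs) (t ∷ ts) fs zero    = t
  colour-lookup (x ∷ xs) (t ∷ ts) fs (suc i) = colour-lookup xs ts fs i

  bipartite-≅ : ∀ {a b} → (∀ u v → ∣ u ~? v ∣ ≡ bit (c u xor c v)) →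
                trues (allFin n) ≡ a → falses (allFin n) ≡ b → G ≅ completeBipartite a b
  bipartite-≅ {a} {b} edge #t #f =
      mk↔ₛ′ to from to∘from from∘to
    , λ u v → ∣∣-⇔ (u ~? v) (Graph._~?_ K (to u) (to v))
        (trans (edge u v) (trans (cong₂ (λ i j → bit (i xor j)) (to-colour u) (to-colour v))
                                 (sym (bipartite (to u) (to v)))))
    where
    open CompleteBipartite a b using (K; left; bipartite)
    len : length sides ≡ a + b
    len = trans (length-++ (side true)) (cong₂ _+_ (trans length-true #t) (trans length-false #f))
    to : Fin n → Fin (a + b)
    to v = cast len (index (sides-complete v))
    from : Fin (a + b) → Fin n
    from i = List.lookup sides (cast (sym len) i)
    from∘to : ∀ v → from (to v) ≡ v
    from∘to v = trans (cong (List.lookup sides) (cast-involutive (sym len) len (index (sides-complete v))))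
                      (sym (lookup-index (sides-complete v)))
    to∘from : ∀ i → to (from i) ≡ i
    to∘from i = trans (cong (cast len) (lookup-injective sides-unique _ (cast (sym len) i)
                        (sym (lookup-index (sides-complete (from i))))))
                      (cast-involutive len (sym len) i)
    to-colour : ∀ v → c v ≡ left (to v)
    to-colour v = begin
      c v ≡⟨ cong c (lookup-index (sides-complete v)) ⟩
      c (List.lookup sides (index (sides-complete v)))
        ≡⟨ colour-lookup (side true) (All.all-filter (λ v → c v ≟ᵇ true) (allFin n))
             (All.all-filter (λ v → c v ≟ᵇ false) (allFin n)) (index (sides-complete v)) ⟩
      toℕ (index (sides-complete v)) <ᵇ length (side true)
        ≡⟨ cong₂ _<ᵇ_ (sym (toℕ-cast len (index (sides-complete v)))) (trans length-true #t) ⟩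
      left (to v) ∎
      where open ≡-Reasoning

-- Equality in Mantel's theorem

x*y≤turán : ∀ x y → x * y ≤ turán (x + y)
x*y≤turán zero    y       = z≤n
x*y≤turán (suc x) zero    = ≤-trans (≤-reflexive (*-zeroʳ x)) z≤n
x*y≤turán (suc x) (suc y) = begin
  suc x * suc y              ≡⟨ suc*suc x y ⟩
  suc (x + y) + x * y        ≤⟨ +-monoʳ-≤ (suc (x + y)) (x*y≤turán x y) ⟩
  suc (x + y) + turán (x + y) ≡⟨ turán-2+ (x + y) ⟨
  turán (suc (suc (x + y)))  ≡⟨ cong (turán ∘ suc) (+-suc x y) ⟨
  turán (suc (x + suc y))    ∎
  where
  open ≤-Reasoning

-- Lowering `x` and `y` by one lowers both sides of the hypothesis by the same amount. Once one of
-- them is zero, the product vanishes, and the hypothesis leaves at most one for the other.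
turán≤x*y⇒balanced : ∀ x y → turán (x + y) ≤ x * y →
  (x ≡ ⌊ x + y /2⌋ × y ≡ ⌈ x + y /2⌉) ⊎ (y ≡ ⌊ x + y /2⌋ × x ≡ ⌈ x + y /2⌉)
turán≤x*y⇒balanced zero          zero          _ = inj₁ (refl , refl)
turán≤x*y⇒balanced zero          (suc zero)    _ = inj₁ (refl , refl)
turán≤x*y⇒balanced zero          (suc (suc y)) ()
turán≤x*y⇒balanced (suc zero)    zero          _ = inj₂ (refl , refl)
turán≤x*y⇒balanced (suc (suc x)) zero          h with ≤-trans h (≤-reflexive (*-zeroʳ x))
... | ()
turán≤x*y⇒balanced (suc x)       (suc y)       h rewrite +-suc x y =
  Sum.map (Product.map (cong suc) (cong suc)) (Product.map (cong suc) (cong suc))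
    (turán≤x*y⇒balanced x y (+-cancelˡ-≤ (suc (x + y)) _ _ (begin
      suc (x + y) + turán (x + y) ≡⟨ turán-2+ (x + y) ⟨
      turán (suc (suc (x + y)))   ≤⟨ h ⟩
      suc x * suc y               ≡⟨ suc*suc x y ⟩
      suc (x + y) + x * y         ∎)))
  where
  open ≤-Reasoning

module Edges {V : Set} {w w′ : V → V → ℕ} (w-sym : ∀ x y → w x y ≡ w y x)
             (w′-sym : ∀ x y → w′ x y ≡ w′ y x) (w≤w′ : ∀ x y → w x y ≤ w′ x y) where
  open Weights w w-sym using (#edges)
  open Weights w′ w′-sym using () renaming (#edges to #edges′)

  #edges-mono : ∀ xs → #edges xs ≤ #edges′ xs
  #edges-mono []       = z≤n
  #edges-mono (x ∷ xs) = +-mono-≤ (∑-mono xs (w≤w′ x)) (#edges-mono xs)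

  -- Only entries at different positions are ever paired in an edge count, so nothing is learnt
  -- about the diagonal; hence `x ≢ y`.
  #edges-≡ : ∀ xs → #edges′ xs ≤ #edges xs → ∀ {x y} → x ∈ xs → y ∈ xs → x ≢ y → w x y ≡ w′ x y
  #edges-≡ (z ∷ xs) ge = λ where
      (here refl) (here refl) x≢y → ⊥-elim (x≢y refl)
      (here refl) (there y∈)  _   → All.lookup row y∈
      (there x∈)  (here refl) _   → trans (w-sym _ _) (trans (All.lookup row x∈) (w′-sym _ _))
      (there x∈)  (there y∈)  x≢y → #edges-≡ xs rest x∈ y∈ x≢y
    where
    row : All (λ y → w z y ≡ w′ z y) xs
    row = ∑-≡ xs (w≤w′ z) (+-cancelʳ-≤ (#edges′ xs) _ _
            (≤-trans ge (+-monoʳ-≤ (∑ xs (w z)) (#edges-mono xs))))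
    rest : #edges′ xs ≤ #edges xs
    rest = +-cancelˡ-≤ (∑ xs (w′ z)) _ _
             (≤-trans ge (+-monoˡ-≤ (#edges xs) (∑-mono xs (w≤w′ z))))

module _ {V : Set} (c : V → Bool) where
  open Colouring c

  colourWeight : V → V → ℕ
  colourWeight u v = bit (c u xor c v)

  colourWeight-sym : ∀ u v → colourWeight u v ≡ colourWeight v u
  colourWeight-sym u v = bit-xor-comm (c u) (c v)

  #edges-colour : ∀ xs → Weights.#edges colourWeight colourWeight-sym xs ≡ trues xs * falses xs
  #edges-colour []       = refl
  #edges-colour (x ∷ xs) with c x
  ... | true  = cong (falses xs +_) (#edges-colour xs)
  ... | false = trans (cong (trues xs +_) (#edges-colour xs)) (sym (*-suc (trues xs) (falses xs)))

pick-∈ : {V : Set} {x z : V} {xs ys : List V} → Pick x xs ys → z ∈ xs → z ≡ x ⊎ z ∈ ys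
pick-∈ here      (here e)   = inj₁ e
pick-∈ here      (there z∈) = inj₂ z∈
pick-∈ (there p) (here e)   = inj₂ (here e)
pick-∈ (there p) (there z∈) = Sum.map₂ there (pick-∈ p z∈)

length-allFin : ∀ n → length (allFin n) ≡ n
length-allFin n = length-tabulate {n = n} (λ v → v)

module Extremal {n : ℕ} (G : Graph (Fin n)) (tf : TriangleFree G) where
  open Graph G
  open Paths G

  private
    K = completeBipartite ⌊ n /2⌋ ⌈ n /2⌉

  -- In the extremal case every vertex is adjacent to exactly one end of a fixed edge ab, so G is
  -- bipartite with parts the neighbourhoods of a and b.
  neighbour-colouring : 1 ≤ turán n → turán n ≤ #edges (allFin n) →
    ∃ λ (c : Fin n → Bool) → ∀ u v → e u v ≤ bit (c u xor c v)
  neighbour-colouring pos ge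
    with mantel-sharp tf (allFin n) (subst (λ l → 1 ≤ turán l) (sym (length-allFin n)) pos)
                      (subst (λ l → turán l ≤ #edges (allFin n)) (sym (length-allFin n)) ge)
  ... | pickedEdge {a} {b} {ys} {zs} pa pb ab , one = (λ z → does (a ~? z)) , below
    where
    -- Sharpness speaks of the vertices other than `a` and `b`; each of these two is adjacent to the
    -- other and not to itself.
    exactly-one : ∀ z → e a z + e b z ≡ 1
    exactly-one z with pick-∈ pa (∈-allFin z)
    ... | inj₁ refl = cong₂ _+_ (∣∣-no (z ~? z) ~-irrefl) (∣∣-yes (b ~? z) (~-sym ab))
    ... | inj₂ z∈ with pick-∈ pb z∈
    ...   | inj₁ refl = cong₂ _+_ (∣∣-yes (a ~? z) ab) (∣∣-no (z ~? z) ~-irrefl)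
    ...   | inj₂ z∈′  = All.lookup one z∈′
    other : ∀ z → ¬ (a ~ z) → b ~ z
    other z ¬az with a ~? z | b ~? z | exactly-one z
    ... | yes az | _      | _ = ⊥-elim (¬az az)
    ... | no _   | yes bz | _ = bz
    ... | no _   | no _   | ()
    below : ∀ u v → e u v ≤ bit (does (a ~? u) xor does (a ~? v))
    below u v with u ~? v
    ... | no _ = z≤n
    ... | yes uv with a ~? u | a ~? v
    ...   | yes au | yes av = ⊥-elim (tf a u v (au , uv , ~-sym av))
    ...   | yes _  | no _   = ≤-refl
    ...   | no _   | yes _  = ≤-refl
    ...   | no ¬au | no ¬av = ⊥-elim (tf b u v (other u ¬au , uv , ~-sym (other v ¬av)))

  module _ (ge : turán n ≤ #edges (allFin n)) (c : Fin n → Bool)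
           (below : ∀ u v → e u v ≤ bit (c u xor c v)) where
    open Colouring c

    private
      t = trues (allFin n)
      f = falses (allFin n)
      t+f≡n : t + f ≡ n
      t+f≡n = trans (trues+falses (allFin n)) (length-allFin n)

    open Edges e-sym (colourWeight-sym c) below

    edge : ∀ u v → e u v ≡ bit (c u xor c v)
    edge u v with u ≟ᶠ v
    ... | yes refl = trans (∣∣-no (u ~? u) ~-irrefl) (sym (xor-self (c u)))
      where
      xor-self : ∀ x → bit (x xor x) ≡ 0
      xor-self true  = refl
      xor-self false = refl
    ... | no u≢v = #edges-≡ (allFin n) (begin
      Weights.#edges (colourWeight c) (colourWeight-sym c) (allFin n) ≡⟨ #edges-colour c (allFin n) ⟩
      t * f           ≤⟨ x*y≤turán t f ⟩
      turán (t + f)   ≡⟨ cong turán t+f≡n ⟩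
      turán n         ≤⟨ ge ⟩
      #edges (allFin n) ∎) (∈-allFin u) (∈-allFin v) u≢v
      where open ≤-Reasoning

    -- The number of edges is at most `t * f`, which is at most `turán n`, which is at most the
    -- number of edges. The equalities make `G` complete between the colour classes and the classes
    -- balanced.
    coloured⇒≅ : G ≅ K
    coloured⇒≅ with turán≤x*y⇒balanced t f (begin
      turán (t + f)     ≡⟨ cong turán t+f≡n ⟩
      turán n           ≤⟨ ge ⟩
      #edges (allFin n) ≤⟨ #edges-mono (allFin n) ⟩
      Weights.#edges (colourWeight c) (colourWeight-sym c) (allFin n) ≡⟨ #edges-colour c (allFin n) ⟩
      t * f             ∎)
      where open ≤-Reasoning
    ... | inj₁ (t≡ , f≡) = BipartiteIso.bipartite-≅ G c edge
            (trans t≡ (cong ⌊_/2⌋ t+f≡n)) (trans f≡ (cong ⌈_/2⌉ t+f≡n))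
    -- Here the `false` class has the rounded-down size of the first part of `K`, so the colours are
    -- exchanged.
    ... | inj₂ (f≡ , t≡) = BipartiteIso.bipartite-≅ G (not ∘ c)
            (λ u v → trans (edge u v) (sym (bit-xor-not (c u) (c v))))
            (trans f≡ (cong ⌊_/2⌋ t+f≡n))
            (trans (∑-cong (allFin n) λ v → not-not (c v)) (trans t≡ (cong ⌈_/2⌉ t+f≡n)))
      where
      not-not : ∀ x → bit (not (not x)) ≡ bit x
      not-not true  = refl
      not-not false = refl

mantel-≅ : ∀ {n} (G : Graph (Fin n)) → TriangleFree G →
           turán n ≤ InGraph.#edges G (allFin n) → G ≅ completeBipartite ⌊ n /2⌋ ⌈ n /2⌉
-- On at most one vertex `turán` is zero and there is no edge to colour by; a constant colouring
-- serves.
mantel-≅ {zero} G tf ge = Extremal.coloured⇒≅ G tf ge (λ _ → false) λ ()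
mantel-≅ {suc zero} G tf ge = Extremal.coloured⇒≅ G tf ge (λ _ → false)
  λ { zero zero → ≤-reflexive (∣∣-no (Graph._~?_ G zero zero) (Graph.~-irrefl G)) }
mantel-≅ {suc (suc n)} G tf ge =
  let c , below = Extremal.neighbour-colouring G tf (s≤s z≤n) ge in Extremal.coloured⇒≅ G tf ge c below

-- From oriented paths to the path number

paths-one : ∀ {V : Set} (G : Graph V) xs → Paths.paths G 1 xs ≡ 2 * InGraph.#edges G xs
paths-one G xs =
  trans (∑ᵖ-cong xs λ x ys → ∑ᵖ-cong ys λ y zs → *-identityʳ _) (∑ᵖ²-edges xs)
  where open InGraph G

bipartitePaths-one : ∀ x y → bipartitePaths 1 x y ≡ 2 * (x * y)
bipartitePaths-one = expand
  where
  expand : ∀ x y → x * (y * 1) + y * (x * 1) ≡ 2 * (x * y)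
  expand = solve-∀

pn≡∑ : ∀ {n} (G : Graph (Fin n)) → pn G ≡ ∑ (upTo n) (pnᵢ G)
pn≡∑ {n} G = go (upTo n)
  where
  go : ∀ is → sum (map (pnᵢ G) is) ≡ ∑ is (pnᵢ G)
  go []       = refl
  go (i ∷ is) = cong (pnᵢ G i +_) (go is)

-- The orders are only propositionally equal: the bipartite graph lives on
-- `Fin (⌊ n /2⌋ + ⌈ n /2⌉)`. Taking the equation as a parameter avoids transporting a graph; it is
-- used just for the range of path lengths.
module Comparison {m n : ℕ} (m≡n : m ≡ n) (G : Graph (Fin m)) (H : Graph (Fin n)) where
  private
    #paths : {l : ℕ} → Graph (Fin l) → ℕ → ℕ
    #paths {l} F k = Paths.paths F k (allFin l)

    #aut : ℕ → ℕ
    #aut k = Copies.#aut (pathGraph (suc k))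

    #aut-nonZero : ∀ k → NonZero (#aut k)
    #aut-nonZero k = >-nonZero (Copies.#aut-pos (pathGraph (suc k)))

    pnᵢ*#aut : {l : ℕ} (F : Graph (Fin l)) (k : ℕ) → pnᵢ F k * #aut k ≡ #paths F k
    pnᵢ*#aut F = PathEmbeddings.pnᵢ*#aut F

    pn-H : pn H ≡ ∑ (upTo m) (pnᵢ H)
    pn-H = trans (pn≡∑ H) (cong (λ l → ∑ (upTo l) (pnᵢ H)) (sym m≡n))

  pn-cong : (∀ k → #paths G k ≡ #paths H k) → pn G ≡ pn H
  pn-cong eq = trans (pn≡∑ G) (trans (∑-cong (upTo m) λ k →
    *-cancelʳ-≡ _ _ (#aut k) {{#aut-nonZero k}}
      (trans (pnᵢ*#aut G k) (trans (eq k) (sym (pnᵢ*#aut H k))))) (sym pn-H))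

  module _ (paths≤ : ∀ k → #paths G k ≤ #paths H k) where
    private
      pnᵢ≤ : ∀ k → pnᵢ G k ≤ pnᵢ H k
      pnᵢ≤ k = *-cancelʳ-≤ _ _ (#aut k) {{#aut-nonZero k}} (begin
        pnᵢ G k * #aut k ≡⟨ pnᵢ*#aut G k ⟩
        #paths G k       ≤⟨ paths≤ k ⟩
        #paths H k       ≡⟨ pnᵢ*#aut H k ⟨
        pnᵢ H k * #aut k ∎)
        where open ≤-Reasoning

    pn-mono : pn G ≤ pn H
    pn-mono = begin
      pn G                ≡⟨ pn≡∑ G ⟩
      ∑ (upTo m) (pnᵢ G) ≤⟨ ∑-mono (upTo m) pnᵢ≤ ⟩
      ∑ (upTo m) (pnᵢ H) ≡⟨ pn-H ⟨
      pn H                ∎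
      where open ≤-Reasoning

    pn-≡⇒paths-≡ : pn G ≡ pn H → ∀ {k} → k < m → #paths G k ≡ #paths H k
    pn-≡⇒paths-≡ eq {k} k<m = begin
      #paths G k       ≡⟨ pnᵢ*#aut G k ⟨
      pnᵢ G k * #aut k ≡⟨ cong (_* #aut k) (All.lookup pnᵢ≡ (∈-upTo⁺ k<m)) ⟩
      pnᵢ H k * #aut k ≡⟨ pnᵢ*#aut H k ⟩
      #paths H k       ∎
      where
      open ≡-Reasoning
      pnᵢ≡ : All (λ k → pnᵢ G k ≡ pnᵢ H k) (upTo m)
      pnᵢ≡ = ∑-≡ (upTo m) pnᵢ≤ (≤-reflexive (trans (sym pn-H) (trans (sym eq) (pn≡∑ G))))

theorem3 : ∀ (n : ℕ) → 1 ≤ n → (G : Graph (Fin n)) → TriangleFree G →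
    (pn G ≤ pn (completeBipartite ⌊ n /2⌋ ⌈ n /2⌉)) ×
    ((pn G ≡ pn (completeBipartite ⌊ n /2⌋ ⌈ n /2⌉)) ⇔ (G ≅ completeBipartite ⌊ n /2⌋ ⌈ n /2⌉))
theorem3 n 1≤n G tf = pn-mono paths≤ , mk⇔ (mantel-≅ G tf ∘ turán≤#edges) (pn-cong ∘ paths≡)
  where
  open Comparison (sym (⌊n/2⌋+⌈n/2⌉≡n n)) G (completeBipartite ⌊ n /2⌋ ⌈ n /2⌉)
  open CompleteBipartite ⌊ n /2⌋ ⌈ n /2⌉ using (K; paths-K; paths-≅)

  paths≤ : ∀ k → Paths.paths G k (allFin n) ≤ Paths.paths K k (allFin (⌊ n /2⌋ + ⌈ n /2⌉))
  paths≤ k = begin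
    Paths.paths G k (allFin n)
      ≤⟨ Paths.paths-max G tf k (allFin n) ⟩
    bipartitePaths k ⌊ length (allFin n) /2⌋ ⌈ length (allFin n) /2⌉
      ≡⟨ cong (λ l → bipartitePaths k ⌊ l /2⌋ ⌈ l /2⌉) (length-allFin n) ⟩
    bipartitePaths k ⌊ n /2⌋ ⌈ n /2⌉
      ≡⟨ paths-K k ⟨
    Paths.paths K k (allFin (⌊ n /2⌋ + ⌈ n /2⌉)) ∎
    where open ≤-Reasoning

  paths≡ : G ≅ K → ∀ k → Paths.paths G k (allFin n) ≡ Paths.paths K k (allFin (⌊ n /2⌋ + ⌈ n /2⌉))
  paths≡ iso k = trans (paths-≅ G iso k) (sym (paths-K k))

  turán≤#edges : pn G ≡ pn (completeBipartite ⌊ n /2⌋ ⌈ n /2⌉) → turán n ≤ InGraph.#edges G (allFin n)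
  -- Paths with one edge occur in the sum defining `pn` only if 1 < n; for n = 1 the bound `turán n`
  -- is zero.
  turán≤#edges eq = Sum.[ by-paths-one , (λ { refl → z≤n }) ] (m≤n⇒m<n∨m≡n 1≤n)
    where
    by-paths-one : 1 < n → turán n ≤ InGraph.#edges G (allFin n)
    by-paths-one 1<n = *-cancelˡ-≤ 2 (≤-reflexive (begin
      2 * turán n                                  ≡⟨ bipartitePaths-one ⌊ n /2⌋ ⌈ n /2⌉ ⟨
      bipartitePaths 1 ⌊ n /2⌋ ⌈ n /2⌉             ≡⟨ paths-K 1 ⟨
      Paths.paths K 1 (allFin (⌊ n /2⌋ + ⌈ n /2⌉)) ≡⟨ pn-≡⇒paths-≡ paths≤ eq 1<n ⟨
      Paths.paths G 1 (allFin n)                   ≡⟨ paths-one G (allFin n) ⟩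
      2 * InGraph.#edges G (allFin n)              ∎))
      where open ≡-Reasoning
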